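{- For every partition $\lambda$, there exists a coloring $\kappa$ of the partition graph $G_\lambda$ such that the first $4$ parts of $\operatorname{shape}(\kappa)$ coincide with the first $4$ terms $\delta_1,\delta_2,\delta_3,\delta_4$ of the chromatic difference sequence of $G_\lambda$ (where both sequences are padded with trailing zeros if they have fewer than $4$ terms).
   Context: A partition $\lambda$ is a weakly decreasing finite sequence of positive integers; its (Young) diagram is the left-justified grid of boxes whose rows, from top to bottom, have $\lambda_1,\lambda_2,\dots$ boxes. The partition graph $G_\lambda$ is the graph whose vertices are the boxes of the diagram of $\lambda$, two distinct boxes being adjacent if and only if they lie in the same row or the same column. A coloring of a graph $G$ with vertex set $V$ is a map $\kappa: V\to\mathbb{N}$ with $\kappa(u)\neq\kappa(v)$ whenever $u,v$ are adjacent. Then $\operatorname{shape}(\kappa)$ is the sequence of cardinalities of the color classes (nonempty fibers) of $\kappa$, arranged in weakly decreasing order. A stable set is a set of pairwise non-adjacent vertices. For $i\ge 0$, $\alpha_i(G)$ is the maximum cardinality of a union of $i$ disjoint (possibly empty) stable sets of $G$, and the chromatic difference sequence (CDS) of $G$ is $(\delta_1,\delta_2,\dots)$ with $\delta_i:=\alpha_i(G)-\alpha_{i-1}(G)$ for $i\ge 1$. -}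

module Defs where

open import Data.Fin.Base using (Fin; zero; suc; toℕ)
open import Data.Fin.Properties using (all?)
import Data.Fin.Properties as Fin
open import Data.Fin.Subset using (Subset; _∈_; ⊥; _∩_; ⋃; Empty; ∣_∣)
open import Data.Fin.Subset.Properties
  using (_∈?_; anySubset?; nonempty?; ∉⊥; ∣p∣≤n; ∣⊥∣≡0; ∩-zeroˡ; ∪-identityˡ)
open import Data.List.Base as List
  using (List; []; _∷_; map; concatMap; allFin; deduplicate; length)
open import Data.List.Relation.Unary.All using (All)
open import Data.List.Relation.Unary.Linked using (Linked)
open import Data.Nat.Base using (ℕ; zero; suc; pred; _∸_; _≤_; _≥_; _>_)
open import Data.Nat.Properties using (_≟_; ≤-decTotalOrder; ≤∧≢⇒<; ≤-pred)
open import Data.Product.Base using (Σ-syntax; ∃; ∃-syntax; _×_; _,_; proj₁; proj₂)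
open import Data.Sum.Base using (_⊎_)
import Data.Sum.Base as Sum
open import Data.Vec.Base using (Vec; []; _∷_; tabulate; replicate; toList)
open import Data.Vec.Relation.Unary.All as VecAll using ([]; _∷_)
open import Data.Vec.Relation.Unary.AllPairs as VecAllPairs using ([]; _∷_)
open import Level using (0ℓ)
open import Relation.Binary.Construct.Flip.EqAndOrd using (decTotalOrder)
open import Relation.Binary.Core using (Rel)
open import Relation.Binary.Definitions using (Symmetric; Decidable)
open import Relation.Binary.PropositionalEquality
  using (_≡_; _≢_; refl; sym; trans; cong; subst)
open import Relation.Nullary using (¬_; Dec; yes; no; does; contradiction)
open import Relation.Nullary.Decidable using (map′; _×-dec_; _⊎-dec_; _→-dec_; ¬?)
import Relation.Unary as Unary

open import Data.List.Sort (decTotalOrder ≤-decTotalOrder) using ()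
  renaming (sort to sortDecreasing)

record Graph : Set₁ where
  field
    order  : ℕ
    _~_    : Rel (Fin order) 0ℓ
    _~?_   : Decidable _~_
    ~-sym  : Symmetric _~_
    ~-irr  : ∀ v → ¬ (v ~ v)

  Vertex : Set
  Vertex = Fin order

module _ (G : Graph) where
  open Graph G

  record Coloring : Set where
    field
      color  : Vertex → ℕ
      proper : ∀ u v → u ~ v → color u ≢ color v

  Stable : Subset order → Set
  Stable S = ∀ u v → u ∈ S → v ∈ S → ¬ (u ~ v)

  Disjoint : Rel (Subset order) 0ℓ
  Disjoint S T = Empty (S ∩ T)

  DisjointStableSets : ∀ {i} → Vec (Subset order) i → Set
  DisjointStableSets Ss = VecAll.All Stable Ss × VecAllPairs.AllPairs Disjoint Ss

  UnionSize : ℕ → ℕ → Set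
  UnionSize i k = ∃[ Ss ] DisjointStableSets {i} Ss × ∣ ⋃ (toList Ss) ∣ ≡ k

module _ {G : Graph} (κ : Coloring G) where
  open Graph G
  open Coloring κ

  colorClass : ℕ → Subset order
  colorClass c = tabulate λ v → does (color v ≟ c)

  usedColors : List ℕ
  usedColors = deduplicate _≟_ (map color (allFin order))

  shape : List ℕ
  shape = sortDecreasing (map (λ c → ∣ colorClass c ∣) usedColors)

IsMaximum : Unary.Pred ℕ 0ℓ → Unary.Pred ℕ 0ℓ
IsMaximum P m = P m × (∀ k → P k → k ≤ m)

boundedMaximum : ∀ {P : Unary.Pred ℕ 0ℓ} → Unary.Decidable P → P 0 →
                 ∀ b → (∀ k → P k → k ≤ b) → ∃ (IsMaximum P)
boundedMaximum P? P0 zero    bound = 0 , P0 , bound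
boundedMaximum {P} P? P0 (suc b) bound with P? (suc b)
... | yes Pb = suc b , Pb , bound
... | no ¬Pb = boundedMaximum P? P0 b λ k Pk →
  ≤-pred (≤∧≢⇒< (bound k Pk) λ k≡ → ¬Pb (subst P k≡ Pk))

anyVec? : ∀ {n i} {P : Unary.Pred (Vec (Subset n) i) 0ℓ} → Unary.Decidable P → Dec (∃ P)
anyVec? {i = zero}  P? = map′ ([] ,_) (λ { ([] , p) → p }) (P? [])
anyVec? {i = suc _} P? =
  map′ (λ { (S , Ss , p) → S ∷ Ss , p }) (λ { (S ∷ Ss , p) → S , Ss , p })
       (anySubset? λ S → anyVec? λ Ss → P? (S ∷ Ss))

module _ (G : Graph) where
  open Graph G

  stable? : Unary.Decidable (Stable G)
  stable? S = all? λ u → all? λ v → (u ∈? S) →-dec ((v ∈? S) →-dec ¬? (u ~? v))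

  unionSize? : ∀ i → Unary.Decidable (UnionSize G i)
  unionSize? i k = anyVec? λ Ss →
    (VecAll.all? stable? Ss
      ×-dec VecAllPairs.allPairs? (λ S T → ¬? (nonempty? (S ∩ T))) Ss)
    ×-dec (∣ ⋃ (toList Ss) ∣ ≟ k)

  unionSize-0 : ∀ i → UnionSize G i 0
  unionSize-0 i =
    replicate i ⊥ , (stable i , disjoint i) , trans (cong ∣_∣ (union i)) (∣⊥∣≡0 order)
    where
    stable : ∀ i → VecAll.All (Stable G) (replicate i ⊥)
    stable zero    = []
    stable (suc i) = (λ _ _ u∈⊥ → contradiction u∈⊥ ∉⊥) ∷ stable i

    ⊥-disjoint : ∀ i → VecAll.All (Disjoint G ⊥) (replicate i ⊥)
    ⊥-disjoint zero    = []
    ⊥-disjoint (suc i) = (λ (v , v∈) → ∉⊥ (subst (v ∈_) (∩-zeroˡ ⊥) v∈)) ∷ ⊥-disjoint i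

    disjoint : ∀ i → VecAllPairs.AllPairs (Disjoint G) (replicate i ⊥)
    disjoint zero    = []
    disjoint (suc i) = ⊥-disjoint i ∷ disjoint i

    union : ∀ i → ⋃ (toList (replicate i (⊥ {order}))) ≡ ⊥
    union zero    = refl
    union (suc i) = trans (∪-identityˡ _) (union i)

  α-exists : ∀ i → ∃ (IsMaximum (UnionSize G i))
  α-exists i = boundedMaximum (unionSize? i) (unionSize-0 i) order
    λ { _ (Ss , _ , refl) → ∣p∣≤n (⋃ (toList Ss)) }

  α : ℕ → ℕ
  α i = proj₁ (α-exists i)

  -- The chromatic difference sequence, meaningful for i ≥ 1.  As α is
  -- monotone, the truncated subtraction is the true difference.
  δ : ℕ → ℕ
  δ i = α i ∸ α (pred i)

record Partition : Set where
  field
    parts      : List ℕ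
    positive   : All (_> 0) parts
    decreasing : Linked _≥_ parts

module _ (μ : Partition) where
  open Partition μ

  Box : Set
  Box = Σ[ r ∈ Fin (length parts) ] Fin (List.lookup parts r)

  boxes : List Box
  boxes = concatMap (λ r → map (r ,_) (allFin (List.lookup parts r)))
                    (allFin (length parts))

  -- The list names each box once; vertices of the partition graph are the
  -- positions in it.
  box : Fin (length boxes) → Box
  box = List.lookup boxes

  row col : Fin (length boxes) → ℕ
  row v = toℕ (proj₁ (box v))
  col v = toℕ (proj₂ (box v))

  partitionGraph : Graph
  partitionGraph = record
    { order = length boxes
    ; _~_   = λ u v → u ≢ v × (row u ≡ row v ⊎ col u ≡ col v)
    ; _~?_  = λ u v → ¬? (u Fin.≟ v) ×-dec ((row u ≟ row v) ⊎-dec (col u ≟ col v))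
    ; ~-sym = λ (u≢v , same) → (λ v≡u → u≢v (sym v≡u)) , Sum.map sym sym same
    ; ~-irr = λ v (v≢v , _) → v≢v refl
    }

-- The entry at a 0-based index of a list padded with zeros.
entry : List ℕ → ℕ → ℕ
entry []       _       = 0
entry (x ∷ xs) zero    = x
entry (x ∷ xs) (suc i) = entry xs i

{-# OPTIONS --safe #-}
module Submission where

-- A union of i stable sets has at most i boxes in each row and column, hence at most
-- i (r + c) + #(boxes outside the first r rows and c columns) boxes.  Let U i be the minimum of
-- these bounds over r and c, and n = U 1.  By convexity of the bounds, i n − U i = l₁ + … + lᵢ
-- with 0 = l₁ ≤ l₂ ≤ l₃ ≤ l₄ and lⱼ < j, which leaves 14 possibilities for l.  It suffices to
-- place colours 0, …, 3 properly in λ so that colour k (from 0) is used at least n − lₖ₊₁ times: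
-- then the first i of these classes cover at least U i boxes for every i ≤ 4, so that α i = U i,
-- and a proper colouring that attains all these maxima has the required shape.
--
-- The colours are placed row by row from the bottom.  All that matters about the rows already
-- filled is, for each column, the set of colours still absent from it.  Boxes at a bounded
-- distance beyond the n-th antidiagonal can be ignored, and columns that lack no colour are
-- forgotten, so that only finitely many configurations occur.  The bounds i n − (l₁ + … + lᵢ) on
-- all cuts restrict how the boundary of λ may continue, and under these restrictions a greedy
-- choice never gets stuck.  This is checked by computing the set of reachable configurations.

open import Defs
open import Data.Bool.Base using (Bool; true; false; if_then_else_)
import Data.Bool.Properties as Bool
open import Data.Fin.Base using (Fin; zero; suc; toℕ; fromℕ<)
open import Data.Fin.Patterns
import Data.Fin.Properties as Fin
open import Data.Fin.Subset using (Subset; ∣_∣; ⋃; _∈_; _∪_; _∩_; ⊥; Empty)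
open import Data.Fin.Subset.Properties
  using (x∈p∪q⁻; x∈p∩q⁻; ∉⊥; ∣⊥∣≡0; ∪-identityˡ; drop-∷-Empty)
open import Data.List.Base as List
  using (List; []; _∷_; _++_; map; foldr; drop; length; filter; allFin; upTo; cartesianProduct)
open import Data.List.Properties
  using (map-∘; length-map; length-++; length-upTo; length-tabulate; drop-all; ++-identityʳ)
  renaming (≡-dec to List-≡-dec)
import Data.List.Membership.Propositional as List
open import Data.List.Membership.Propositional.Properties
  using (∈-map⁺; ∈-map⁻; ∈-concatMap⁺; ∈-allFin; ∈-upTo⁺; ∈-++⁺ˡ; ∈-++⁺ʳ; ∈-cartesianProduct⁺;
         ∈-∃++; ∈-lookup; ∈-filter⁻; ∈-deduplicate⁺)
open import Data.List.Relation.Binary.Permutation.Propositional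
  using (_↭_; prep; swap; ↭-refl; ↭-sym; ↭-trans; ↭⇒↭ₛ)
open import Data.List.Relation.Binary.Permutation.Propositional.Properties
  using (All-resp-↭; ∈-resp-↭; ↭-map-inv; ↭-length; shift; ++⁺ʳ; map⁺)
import Data.List.Relation.Binary.Permutation.Setoid.Properties as Permutationₛ
open import Data.List.Relation.Unary.All as All using (All; []; _∷_)
import Data.List.Relation.Unary.All.Properties as All
open import Data.List.Relation.Unary.AllPairs as AllPairs using (AllPairs; []; _∷_)
import Data.List.Relation.Unary.AllPairs.Properties as AllPairs
open import Data.List.Relation.Unary.Any as Any using (here; there)
import Data.List.Relation.Unary.Any.Properties as Any
open import Data.List.Relation.Unary.Linked.Properties using (Linked⇒AllPairs)
open import Data.List.Relation.Unary.Unique.DecPropositional.Properties using (deduplicate-!)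
open import Data.List.Relation.Unary.Unique.Propositional using (Unique)
import Data.List.Relation.Unary.Unique.Propositional.Properties as Unique
open import Data.Maybe.Base as Maybe using (Maybe; just; nothing; maybe′; _<∣>_)
import Data.Maybe.Relation.Unary.Any as MaybeAny
open MaybeAny using (just)
open import Data.Nat.Base
open import Data.Nat.ListAction using (sum)
open import Data.Nat.ListAction.Properties using (sum-↭)
open import Data.Nat.Properties
open import Data.Nat.Tactic.RingSolver using (solve-∀)
import Data.List.Extrema ≤-totalOrder as Extrema
open import Data.Product.Base using (∃; ∃-syntax; Σ-syntax; _×_; _,_; proj₁; proj₂)
open import Data.Sum.Base using (_⊎_; inj₁; inj₂; [_,_]′)
open import Data.Unit.Base using (⊤; tt)
open import Data.Vec.Base as Vec using (Vec; []; _∷_; lookup; _[_]≔_; toList)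
open import Data.Vec.Membership.Propositional.Properties using () renaming (∈-lookup to Vec∈-lookup)
open import Data.Vec.Properties
  using (lookup∘update; lookup∘update′; lookup∘tabulate; []=⇒lookup; lookup⇒[]=)
  renaming (≡-dec to Vec-≡-dec)
open import Data.Vec.Relation.Unary.All as VecAll using ([]; _∷_)
open import Data.Vec.Relation.Unary.AllPairs as VecAllPairs using ([]; _∷_)
open import Function.Base using (_∘_; flip; id)
open import Level using (0ℓ)
open import Relation.Binary.Construct.Flip.EqAndOrd using (decTotalOrder)
open import Data.List.Sort (decTotalOrder ≤-decTotalOrder) using (sort-↭; sort-↗)
open import Relation.Binary.Definitions using (Symmetric; _Respects_)
open import Relation.Binary.PropositionalEquality
  using (_≡_; _≢_; refl; sym; trans; cong; cong₂; subst; subst₂; setoid; ≢-sym; resp₂)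
open import Relation.Nullary using (¬_; Dec; yes; no; does; contradiction)
open import Relation.Nullary.Decidable
  using (True; toWitness; dec-true; map′; _×-dec_; _→-dec_; ¬?)
open import Relation.Unary using (Decidable; Pred)

-- The game

Colour : Set
Colour = Fin 4

Kind : Set
Kind = Vec Bool 4

pattern full = true ∷ true ∷ true ∷ true ∷ []
pattern none = false ∷ false ∷ false ∷ false ∷ []

Kinds : Set
Kinds = List Kind

bit : Bool → ℕ → ℕ
bit true  w = w
bit false w = 0

-- The order in which columns are tried; it was found by experiment.
weight : Kind → ℕ
weight (a ∷ b ∷ c ∷ d ∷ []) = bit a 4 + bit b 8 + bit c 2 + bit d 1

insert : Kind → Kinds → Kinds
insert x []       = x ∷ []
insert x (y ∷ ys) = if weight x <ᵇ weight y then y ∷ insert x ys else x ∷ y ∷ ys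

insert-↭ : ∀ x ys → insert x ys ↭ x ∷ ys
insert-↭ x []       = ↭-refl
insert-↭ x (y ∷ ys) with weight x <ᵇ weight y
... | true  = ↭-trans (prep y (insert-↭ x ys)) (swap y x ↭-refl)
... | false = ↭-refl

stow : Kinds → Kinds → Kinds
stow []         free = free
stow (none ∷ used) free = stow used free
stow (y ∷ used) free = stow used (insert y free)

-- Evidence that a row is legal, independent of the search that finds it. A column moves to `used`
-- once it has received a colour, so it gets at most one colour per row.
data Fill : List Colour → (free used result : Kinds) → Set where
  done  : ∀ {free used} → Fill [] free used (stow used free)
  place : ∀ {k ks free used x rest result} → lookup x k ≡ true → free ↭ x ∷ rest →
          Fill ks rest (x [ k ]≔ false ∷ used) result → Fill (k ∷ ks) free used result
  skip  : ∀ {k ks free used result} → Fill ks free used result → Fill (k ∷ ks) free used result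

Choice : Colour → Kinds → Set
Choice k free = ∃[ x ] ∃[ rest ] (lookup x k ≡ true × free ↭ x ∷ rest)

later : ∀ {k xs} x → Choice k xs → Choice k (x ∷ xs)
later x (y , rest , k∈y , p) = y , x ∷ rest , k∈y , ↭-trans (prep x p) (swap x y ↭-refl)

choices : ∀ k free → List (Choice k free)
choices k []       = []
choices k (x ∷ xs) with lookup x k in eq
... | true  = (x , xs , eq , ↭-refl) ∷ map (later x) (choices k xs)
... | false = map (later x) (choices k xs)

search : ∀ {A B : Set} → (A → Maybe B) → List A → Maybe B
search f []       = nothing
search f (x ∷ xs) = f x <∣> search f xs

-- Depth-first with backtracking. `skip` comes last because a skipped colour loses one unit of slack
-- for good.
fill : (Colour → Bool) → ∀ ks free used → Maybe (∃ (Fill ks free used))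
fill slack []       free used = just (_ , done)
fill slack (k ∷ ks) free used =
  search (λ (x , rest , e , p) → Maybe.map (λ (_ , f) → _ , place e p f) (fill slack ks rest (x [ k ]≔ false ∷ used)))
         (choices k free)
  <∣> (if slack k then Maybe.map (λ (_ , f) → _ , skip f) (fill slack ks free used) else nothing)

colours : List Colour
colours = 0F ∷ 1F ∷ 2F ∷ 3F ∷ []

free# : Colour → Kinds → ℕ
free# k xs = sum (map (λ x → bit (lookup x k) 1) xs)

-- level is (rows above) + (columns opened) − n, and mⱼ bounds the number of boxes that the rows
-- filled so far have in the last j open columns.
record State : Set where
  constructor state
  field
    kinds  : Kinds
    level  : ℕ
    m₁ m₂ m₃ : ℕ
open State

data Tree : Set where
  leaf : Tree
  node : ℕ → State → Tree → Tree → Tree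

-- Only a search key: that different states have different codes is never used.
code : State → ℕ
code s = level s + 8 * foldr (λ x c → weight x + 16 * c) 0 (kinds s)

find : ℕ → Tree → Maybe State
find c leaf = nothing
find c (node d s l r) = if c <ᵇ d then find c l else if d <ᵇ c then find c r else just s

AllTree : Pred State 0ℓ → Tree → Set
AllTree P leaf           = ⊤
AllTree P (node _ s l r) = P s × AllTree P l × AllTree P r

allTree? : ∀ {P} → Decidable P → Decidable (AllTree P)
allTree? P? leaf           = yes tt
allTree? P? (node _ s l r) = P? s ×-dec allTree? P? l ×-dec allTree? P? r

loss : Vec ℕ 4 → Fin 4 → ℕ
loss l 0F = lookup l 0F
loss l 1F = lookup l 0F + lookup l 1F
loss l 2F = lookup l 0F + lookup l 1F + lookup l 2F
loss l 3F = lookup l 0F + lookup l 1F + lookup l 2F + lookup l 3F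

-- l k is the number of boxes that colour k may miss; a colour whose slack is used up has to
-- appear in every further row.
module Game (cap : ℕ) (l : Vec ℕ 4) where

  _≼_ : State → State → Set
  s ≼ t = level s ≡ level t × kinds s ≡ kinds t × m₁ s ≤ m₁ t × m₂ s ≤ m₂ t × m₃ s ≤ m₃ t

  _≼?_ : ∀ s t → Dec (s ≼ t)
  s ≼? t = level s ≟ level t ×-dec List-≡-dec (Vec-≡-dec Bool._≟_) (kinds s) (kinds t)
           ×-dec m₁ s ≤? m₁ t ×-dec m₂ s ≤? m₂ t ×-dec m₃ s ≤? m₃ t

  Move : State → Set
  Move s = ∃ (Fill colours (kinds s) [])

  -- The slack `level s + lookup l k` minus `free# k (kinds s)` is unchanged by `right`, and by `up`
  -- and `over` when colour k is placed; skipping k lowers it by one. The strict test therefore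
  -- preserves `within`.
  move : ∀ s → Maybe (Move s)
  move s = fill (λ k → free# k (kinds s) <ᵇ level s + lookup l k) colours (kinds s) []

  -- A bound above 4 + (the previous one) carries no information, since i ≤ 4.
  trim : Kinds → ℕ → ℕ → ℕ → ℕ → State
  trim ks p a b c = let b′ = b ⊓ (a ⊓ 4 + 4) in state ks p (a ⊓ 4) b′ (c ⊓ (b′ + 4))

  -- Below the cap a new column starts beyond the ends of all filled rows, so it gets bound 0 and
  -- the old bounds shift by one column.
  right : State → State
  right (state ks p a b c) = trim (insert full ks) (suc p) 0 a b

  -- The filled row ends exactly at the last open column and so adds j boxes to the last j columns.
  up : State → Kinds → State
  up (state _ p a b c) ks = trim ks (pred p) (1 + a) (2 + b) (3 + c)

  -- At level cap further columns are opened only one at a time, each after filling a row; their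
  -- boxes in earlier rows are not counted, so all bounds are reset.
  over : State → Kinds → State
  over s ks = state (insert full ks) (level s) 4 8 12

  -- The cut inequality for the first r rows and ℓ - j columns, after substituting r + ℓ = n + p and
  -- cancelling (i + 1) n; m bounds the boxes outside that cut.
  Promise : ℕ → ℕ → ℕ → Set
  Promise p j m = ∀ i → suc (toℕ i) * j ≤ m + suc (toℕ i) * p + loss l i

  promise? : ∀ p j m → Dec (Promise p j m)
  promise? p j m = Fin.all? λ i → _ ≤? _

  -- Evaluated at the position after `up`: a row ending at the last open column is ruled out if it
  -- would violate a cut inequality. Positivity of the level reflects that row r has at least n - r
  -- boxes.
  Possible : State → Set
  Possible s = 0 < level s × Promise p 1 (1 + m₁ s) × Promise p 2 (2 + m₂ s) × Promise p 3 (3 + m₃ s)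
    where p = pred (level s)

  possible? : Decidable Possible
  possible? s =
    0 <? level s ×-dec promise? _ 1 (1 + m₁ s) ×-dec promise? _ 2 (2 + m₂ s) ×-dec promise? _ 3 (3 + m₃ s)

  Covers : Tree → State → Set
  Covers t s = MaybeAny.Any (s ≼_) (find (code s) t)

  covers? : ∀ t → Decidable (Covers t)
  covers? t s = MaybeAny.dec (s ≼?_) (find (code s) t)

  -- Closure of the table under every continuation of the boundary, answered by `move`. `within` is
  -- what turns the final position into a count of colour k.
  record Safe (t : Tree) (s : State) : Set where
    constructor safe
    field
      within : ∀ k → free# k (kinds s) ≤ level s + lookup l k
      →right : level s < cap → Covers t (right s)
      →up    : Possible s → MaybeAny.Any (λ mv → Covers t (up s (proj₁ mv))) (move s)
      →over  : ¬ (level s < cap) → MaybeAny.Any (λ mv → Covers t (over s (proj₁ mv))) (move s)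

  safe? : ∀ t → Decidable (Safe t)
  safe? t s = map′ (λ (a , b , c , d) → safe a b c d) (λ (safe a b c d) → a , b , c , d)
    ((Fin.all? λ k → _ ≤? _)
     ×-dec ((level s <? cap) →-dec covers? t (right s))
     ×-dec (possible? s →-dec MaybeAny.dec (λ mv → covers? t (up s (proj₁ mv))) (move s))
     ×-dec (¬? (level s <? cap) →-dec MaybeAny.dec (λ mv → covers? t (over s (proj₁ mv))) (move s)))

  next : State → List State
  next s = (if does (level s <? cap) then right s ∷ [] else moves over)
        ++ (if does (possible? s) then moves up else [])
    where moves : (State → Kinds → State) → List State
          moves f = maybe′ (λ mv → f s (proj₁ mv) ∷ []) [] (move s)

  -- Larger bounds mean fewer constraints on λ, so the join is the harder position.
  join : State → State → State
  join (state ks p a b c) (state _ _ a′ b′ c′) = state ks p (a ⊔ a′) (b ⊔ b′) (c ⊔ c′)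

  add : ℕ → State → Tree → Maybe (State × Tree)
  add c s leaf = just (s , node c s leaf leaf)
  add c s (node d u l r) =
    if c <ᵇ d then Maybe.map (λ (w , t) → w , node d u t r) (add c s l) else
    if d <ᵇ c then Maybe.map (λ (w , t) → w , node d u l t) (add c s r) else
    if does (s ≼? u) then nothing else just (join s u , node d (join s u) l r)

  explore : ℕ → List State → Tree → Tree
  explore zero    _          t = t
  explore (suc n) []         t = t
  explore (suc n) (s ∷ todo) t with add (code s) s t
  ... | nothing        = explore n todo t
  ... | just (s′ , t′) = explore n (next s′ ++ todo) t′

  -- The bound 4 j fulfils every `Promise`, since (i + 1) j ≤ 4 j; so 4, 8 and 12 carry no
  -- information.
  start : ℕ → State
  start p = state [] p 4 8 12

  starts : List State
  starts = map start (upTo (suc cap))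

  -- A candidate invariant found by saturation. Nothing is proved about `explore`: `won?` checks the
  -- closure of its result, and 5000 is merely fuel.
  table : Tree
  table = explore 5000 starts leaf

  Won : Set
  Won = AllTree (Safe table) table × All (Covers table) starts

  won? : Dec Won
  won? = allTree? (safe? table) table ×-dec All.all? (covers? table) starts

-- Boards

AllPairs-resp-↭ : ∀ {A : Set} {R : A → A → Set} → Symmetric R → AllPairs R Respects _↭_
AllPairs-resp-↭ {A} {R} R-sym p = Permutationₛ.AllPairs-resp-↭ (setoid A) R-sym (resp₂ R) (↭⇒↭ₛ p)

record Mark : Set where
  constructor mark
  field
    colour  : Colour
    atRow atCol : ℕ
open Mark

Compatible : Mark → Mark → Set
Compatible e f = (atRow e ≡ atRow f → atCol e ≢ atCol f × colour e ≢ colour f)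
               × (atCol e ≡ atCol f → colour e ≢ colour f)

placed : Colour → List Mark → ℕ
placed k = sum ∘ map (λ e → bit (does (colour e Fin.≟ k)) 1)

Column : Set
Column = Kind × ℕ

Available : List Mark → Column → Set
Available E (x , c) = ∀ k → lookup x k ≡ true → All (λ e → colour e ≡ k → atCol e ≢ c) E

free#-↭ : ∀ k {xs ys} → xs ↭ ys → free# k xs ≡ free# k ys
free#-↭ k = sum-↭ ∘ map⁺ (λ x → bit (lookup x k) 1)

free#-fill : ∀ (k k′ : Colour) (x : Kind) → bit (lookup x k′) 1 ≤ bit (does (k Fin.≟ k′)) 1 + bit (lookup (x [ k ]≔ false) k′) 1
free#-fill k k′ x with k Fin.≟ k′
... | yes refl = ≤-trans (bit≤1 (lookup x k)) (s≤s z≤n)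
  where bit≤1 : ∀ b → bit b 1 ≤ 1
        bit≤1 true  = ≤-refl
        bit≤1 false = z≤n
... | no k≢k′ rewrite lookup∘update′ (≢-sym k≢k′) x false = ≤-refl

module Boards (parts : List ℕ) where

  -- Rows from r on are processed and ℓ columns are opened. For `count`, each opened column is
  -- charged to colour k either by a mark or by the absence of k, which is why a column of kind
  -- `none` may be dropped from `T`.
  record Board (r ℓ : ℕ) (T : List Column) (E : List Mark) : Set where
    field
      distinct   : AllPairs (λ t u → proj₂ t ≢ proj₂ u) T
      bounded    : All (λ t → proj₂ t < ℓ) T
      available  : All (Available E) T
      compatible : AllPairs Compatible E
      inside     : All (λ e → r ≤ atRow e × atCol e < ℓ × atCol e < entry parts (atRow e)) E
      count      : ∀ k → ℓ ≤ placed k E + free# k (map proj₁ T)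
  open Board

  empty : ∀ r → Board r 0 [] []
  empty r = record { distinct = [] ; bounded = [] ; available = [] ; compatible = [] ; inside = [] ; count = λ _ → z≤n }

  permute : ∀ {r ℓ T U E} → T ↭ U → Board r ℓ T E → Board r ℓ U E
  permute {r} {ℓ} {T} {U} {E} p b = record
    { distinct   = AllPairs-resp-↭ ≢-sym p (distinct b)
    ; bounded    = All-resp-↭ p (bounded b)
    ; available  = All-resp-↭ p (available b)
    ; compatible = compatible b
    ; inside     = inside b
    ; count      = λ k → subst (λ f → ℓ ≤ placed k E + f) (free#-↭ k (map⁺ proj₁ p)) (count b k)
    }

  dropNone : ∀ {r ℓ c T E} → Board r ℓ ((none , c) ∷ T) E → Board r ℓ T E
  dropNone {r} {ℓ} {c} {T} {E} b = record
    { distinct   = AllPairs.tail (distinct b)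
    ; bounded    = All.tail (bounded b)
    ; available  = All.tail (available b)
    ; compatible = compatible b
    ; inside     = inside b
    ; count      = λ k → subst (λ z → ℓ ≤ placed k E + (bit z 1 + free# k (map proj₁ T))) (none-free k) (count b k)
    }
    where none-free : ∀ k → lookup none k ≡ false
          none-free 0F = refl
          none-free 1F = refl
          none-free 2F = refl
          none-free 3F = refl

  raise : ∀ {r ℓ T E} → Board (suc r) ℓ T E → Board r ℓ T E
  raise b = record
    { distinct = distinct b ; bounded = bounded b ; available = available b ; compatible = compatible b
    ; inside = All.map (λ (h , i) → <⇒≤ h , i) (inside b) ; count = count b }

  -- All marks lie left of column ℓ, so the new column lacks every colour and pays for the increment
  -- of ℓ in `count`.
  widen : ∀ {r ℓ T E} → Board r ℓ T E → Board r (suc ℓ) ((full , ℓ) ∷ T) E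
  widen {ℓ = ℓ} {T} {E} b = record
    { distinct   = All.map (≢-sym ∘ <⇒≢) (bounded b) ∷ distinct b
    ; bounded    = ≤-refl ∷ All.map m<n⇒m<1+n (bounded b)
    ; available  = (λ _ _ → All.map (λ (_ , c<ℓ , _) _ → <⇒≢ c<ℓ) (inside b)) ∷ available b
    ; compatible = compatible b
    ; inside     = All.map (λ (h , c<ℓ , i) → h , m<n⇒m<1+n c<ℓ , i) (inside b)
    ; count      = λ k → subst (λ z → suc ℓ ≤ placed k E + (bit z 1 + free# k (map proj₁ T))) (sym (full-free k))
                     (subst (suc ℓ ≤_) (sym (+-suc (placed k E) _)) (s≤s (count b k)))
    }
    where full-free : ∀ k → lookup full k ≡ true
          full-free 0F = refl
          full-free 1F = refl
          full-free 2F = refl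
          full-free 3F = refl

  Fresh : ℕ → List Mark → Column → Set
  Fresh r E (_ , c) = All (λ e → atRow e ≡ r → atCol e ≢ c) E

  Pending : ℕ → List Mark → Colour → Set
  Pending r E k = All (λ e → atRow e ≡ r → colour e ≢ k) E

  -- In `count`, the new mark replaces the absence of k in column c, and the absences of other
  -- colours are untouched.
  addMark : ∀ {r ℓ k x c T E} → Board r ℓ ((x , c) ∷ T) E → lookup x k ≡ true → ℓ ≤ entry parts r →
            Fresh r E (x , c) → Pending r E k →
            Board r ℓ ((x [ k ]≔ false , c) ∷ T) (mark k r c ∷ E)
  addMark {r} {ℓ} {k} {x} {c} {T} {E} b free ℓ≤ fresh pending
    with c<ℓ ∷ T<ℓ ← bounded b | c≢ ∷ dis ← distinct b | av ∷ avs ← available b = record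
    { distinct   = c≢ ∷ dis
    ; bounded    = c<ℓ ∷ T<ℓ
    ; available  = (λ k′ free′ → (λ k≡k′ → contradiction (subst (λ z → lookup (x [ k ]≔ false) z ≡ true) (sym k≡k′) free′) used)
                                 ∷ av k′ (keep k′ free′))
                   ∷ All.zipWith (λ (c≢c′ , a) k′ free′ → (λ _ → c≢c′) ∷ a k′ free′) (c≢ , avs)
    ; compatible = All.zipWith (λ ((f , p) , a) → (λ r≡ → ≢-sym (f (sym r≡)) , ≢-sym (p (sym r≡))) ,
                                              λ c≡ k≡ → a (sym k≡) (sym c≡))
                     (All.zip (fresh , pending) , av k free) ∷ compatible b
    ; inside     = (≤-refl , c<ℓ , <-≤-trans c<ℓ ℓ≤) ∷ inside b
    ; count      = counted
    }
    where
    used : ¬ (lookup (x [ k ]≔ false) k ≡ true)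
    used eq with () ← trans (sym (lookup∘update k x false)) eq
    keep : ∀ k′ → lookup (x [ k ]≔ false) k′ ≡ true → lookup x k′ ≡ true
    keep k′ eq with k Fin.≟ k′
    ... | yes refl = contradiction eq used
    ... | no k≢k′  = trans (sym (lookup∘update′ (≢-sym k≢k′) x false)) eq
    counted : ∀ k′ → ℓ ≤ placed k′ (mark k r c ∷ E) + free# k′ (map proj₁ ((x [ k ]≔ false , c) ∷ T))
    counted k′ = begin
      ℓ                               ≤⟨ count b k′ ⟩
      placed k′ E + (bit (lookup x k′) 1 + F)  ≤⟨ +-monoʳ-≤ (placed k′ E) (+-monoˡ-≤ F {bit (lookup x k′) 1} {m + n} (free#-fill k k′ x)) ⟩
      placed k′ E + (m + n + F)        ≡⟨ cong (placed k′ E +_) (+-assoc m n F) ⟩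
      placed k′ E + (m + (n + F))      ≡⟨ sym (+-assoc (placed k′ E) m (n + F)) ⟩
      placed k′ E + m + (n + F)        ≡⟨ cong (_+ (n + F)) (+-comm (placed k′ E) m) ⟩
      m + placed k′ E + (n + F)        ∎
      where open ≤-Reasoning
            F m n : ℕ
            F = free# k′ (map proj₁ T)
            m = bit (does (k Fin.≟ k′)) 1
            n = bit (lookup (x [ k ]≔ false) k′) 1

  HasKinds : ℕ → ℕ → Kinds → List Mark → Set
  HasKinds r ℓ ks E = ∃[ T ] (map proj₁ T ≡ ks × Board r ℓ T E)

  stow-sound : ∀ {r ℓ E} U T → Board r ℓ (T ++ U) E → HasKinds r ℓ (stow (map proj₁ U) (map proj₁ T)) E
  stow-sound {r} {ℓ} {E} [] T b = T , refl , subst (λ z → Board r ℓ z E) (++-identityʳ T) b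
  stow-sound {r} {ℓ} {E} ((y , c) ∷ U) T b = go y (permute (shift (y , c) T U) b)
    where
    ins : ∀ y → Board r ℓ ((y , c) ∷ T ++ U) E → HasKinds r ℓ (stow (map proj₁ U) (insert y (map proj₁ T))) E
    ins y b with T′ , eq , p ← ↭-map-inv proj₁ {xs = (y , c) ∷ T} (↭-sym (insert-↭ y (map proj₁ T))) rewrite eq =
      stow-sound U T′ (permute (++⁺ʳ U p) b)
    go : ∀ y → Board r ℓ ((y , c) ∷ T ++ U) E → HasKinds r ℓ (stow (y ∷ map proj₁ U) (map proj₁ T)) E
    go none                           b = stow-sound U T (dropNone b)
    -- One clause per position of the first `true`: only then does `stow` reduce past its clause for
    -- `none`.
    go y@(true ∷ _)                   b = ins y b
    go y@(false ∷ true ∷ _)           b = ins y b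
    go y@(false ∷ false ∷ true ∷ _)   b = ins y b
    go y@(false ∷ false ∷ false ∷ true ∷ []) b = ins y b

  -- `Fresh` and `Pending` supply the same-row half of `Compatible` for the next mark; `Available`
  -- supplies the same-column half.
  fill-sound : ∀ {r ℓ ks free used result} → Fill ks free used result → ℓ ≤ entry parts r → AllPairs _≢_ ks →
               ∀ {E} T U → map proj₁ T ≡ free → map proj₁ U ≡ used → Board r ℓ (T ++ U) E →
               All (Fresh r E) T → All (Pending r E) ks → ∃ (HasKinds r ℓ result)
  fill-sound done _ _ T U refl refl b _ _ = _ , stow-sound U T b
  fill-sound (skip f) ℓ≤ (_ ∷ ks≢) T U eq eq′ b fresh (_ ∷ pending) = fill-sound f ℓ≤ ks≢ T U eq eq′ b fresh pending
  fill-sound {r} (place {k} {x = x} free∋ p f) ℓ≤ (k≢ ∷ ks≢) T U refl refl b fresh (pend ∷ pending)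
    with (_ , c) ∷ T′ , refl , q ← ↭-map-inv proj₁ p
    with fr ∷ fresh′ ← All-resp-↭ q fresh
    with b′ ← permute (++⁺ʳ U q) b =
    fill-sound f ℓ≤ ks≢ T′ ((x [ k ]≔ false , c) ∷ U) refl refl
      (permute (↭-sym (shift _ T′ U)) (addMark b′ free∋ ℓ≤ fr pend))
      (All.zipWith (λ (c≢ , fr′) → (λ _ → c≢) ∷ fr′) (All.++⁻ˡ T′ (AllPairs.head (distinct b′)) , fresh′))
      (All.zipWith (λ (k≢k′ , pe) → (λ _ → k≢k′) ∷ pe) (k≢ , pending))

  row-sound : ∀ {r ℓ ks result E} → Fill colours ks [] result → ℓ ≤ entry parts r →
              HasKinds (suc r) ℓ ks E → ∃ (HasKinds r ℓ result)
  row-sound {r} {E = E} f ℓ≤ (T , eq , b) =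
    fill-sound f ℓ≤ colours≢ T [] eq refl (subst (λ T → Board _ _ T E) (sym (++-identityʳ T)) (raise b))
      (All.universal (λ _ → All.map (λ {e} → absurd {e}) (inside b)) T)
      (All.universal (λ _ → All.map (λ {e} → absurd {e}) (inside b)) colours)
    where
    absurd : ∀ {e} {P : Set} {Q : Set} → suc r ≤ atRow e × Q → atRow e ≡ r → P
    absurd (h , _) refl = contradiction h (<-irrefl refl)
    colours≢ : AllPairs _≢_ colours
    colours≢ = ((λ ()) ∷ (λ ()) ∷ (λ ()) ∷ []) ∷ ((λ ()) ∷ (λ ()) ∷ []) ∷ ((λ ()) ∷ []) ∷ [] ∷ []

-- Playing along the boundary of the diagram

outside : List ℕ → ℕ → ℕ
outside xs c = sum (map (_∸ c) xs)

outside-≤ : ∀ {c} xs → All (_≤ c) xs → outside xs c ≡ 0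
outside-≤ []       []           = refl
outside-≤ (x ∷ xs) (x≤c ∷ xs≤c) = cong₂ _+_ (m≤n⇒m∸n≡0 x≤c) (outside-≤ xs xs≤c)

outside-antimono : ∀ {c d} xs → c ≤ d → outside xs d ≤ outside xs c
outside-antimono []       c≤d = z≤n
outside-antimono (x ∷ xs) c≤d = +-mono-≤ (∸-monoʳ-≤ x c≤d) (outside-antimono xs c≤d)

drop-∷ : ∀ r {x xs} (ys : List ℕ) → drop r ys ≡ x ∷ xs → entry ys r ≡ x × drop (suc r) ys ≡ xs
drop-∷ zero    (y ∷ ys) refl = refl , refl
drop-∷ (suc r) (y ∷ ys) eq   = drop-∷ r ys eq

find-All : ∀ {P : Pred State 0ℓ} c t {s} → AllTree P t → find c t ≡ just s → P s
find-All c (node d u l r) (pu , pl , pr) eq with c <ᵇ d | d <ᵇ c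
... | true  | _     = find-All c l pl eq
... | false | true  = find-All c r pr eq
find-All c (node d u l r) (pu , pl , pr) refl | false | false = pu

-- far: a bound 4 above the one for fewer columns yields no constraint of its own, since i ≤ 4.
data Bounded (xs : List ℕ) (ℓ : ℕ) : ℕ → ℕ → Set where
  trivial  : ∀ {m} → Bounded xs ℓ 0 m
  exact : ∀ {j m} c → c + j ≡ ℓ → outside xs c ≤ m → Bounded xs ℓ j m
  far   : ∀ {j m m′} → Bounded xs ℓ j m → m + 4 ≤ m′ → Bounded xs ℓ (suc j) m′

module _ {xs : List ℕ} {ℓ : ℕ} where

  Bounded-mono : ∀ {j m m′} → m ≤ m′ → Bounded xs ℓ j m → Bounded xs ℓ j m′
  Bounded-mono m≤ trivial            = trivial
  Bounded-mono m≤ (exact c eq le) = exact c eq (≤-trans le m≤)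
  Bounded-mono m≤ (far b le)      = far b (≤-trans le m≤)

  Bounded-⊓ : ∀ {j m n} → Bounded xs ℓ j m → Bounded xs ℓ j n → Bounded xs ℓ j (m ⊓ n)
  Bounded-⊓ {m = m} {n} b b′ with ⊓-sel m n
  ... | inj₁ eq rewrite eq = b
  ... | inj₂ eq rewrite eq = b′

  far′ : ∀ {j m} → Bounded xs ℓ j m → Bounded xs ℓ (suc j) (m + 4)
  far′ b = far b ≤-refl

  Bounded-right : ∀ {j m} → outside xs ℓ ≡ 0 → Bounded xs ℓ j m → Bounded xs (suc ℓ) (suc j) m
  Bounded-right out trivial            = exact ℓ (+-comm ℓ 1) (≤-trans (≤-reflexive out) z≤n)
  Bounded-right out (exact c eq le) = exact c (trans (+-suc c _) (cong suc eq)) le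
  Bounded-right out (far b le)      = far (Bounded-right out b) le

  Bounded-up : ∀ {j m} → Bounded xs ℓ j m → Bounded (ℓ ∷ xs) ℓ j (j + m)
  Bounded-up trivial                        = trivial
  Bounded-up {j} (exact c refl le)       = exact c refl (+-mono-≤ (≤-reflexive (m+n∸m≡n c j)) le)
  Bounded-up {suc j} {m′} (far {m = m} b le) = far (Bounded-up b) (begin
    j + m + 4     ≡⟨ +-assoc j m 4 ⟩
    j + (m + 4)   ≤⟨ +-monoʳ-≤ j le ⟩
    j + m′        ≤⟨ n≤1+n _ ⟩
    suc j + m′    ∎)
    where open ≤-Reasoning

module Run (parts : List ℕ) (n cap : ℕ) (l : Vec ℕ 4) (t : Tree) where
  open Game cap l
  open Mark
  open Boards parts
  open State

  module _ (allSafe : AllTree (Safe t) t) (started : ∀ p → p ≤ cap → Covers t (start p))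
           (l₀ : lookup l 0F ≡ 0)
           (cut : ∀ i r c → suc (toℕ i) * n ≤ suc (toℕ i) * (r + c) + outside (drop r parts) c + loss l i) where

    -- `flush` says that below the cap the processed rows lie within the opened columns. At the cap
    -- they may stick out, and their boxes beyond are left blank.
    record Realises (xs : List ℕ) (r ℓ : ℕ) (s : State) : Set where
      constructor realises
      field
        {E}    : List Mark
        real   : HasKinds r ℓ (kinds s) E
        height : r + ℓ ≡ n + level s
        flush  : level s < cap → outside xs ℓ ≡ 0
        b₁     : Bounded xs ℓ 1 (m₁ s)
        b₂     : Bounded xs ℓ 2 (m₂ s)
        b₃     : Bounded xs ℓ 3 (m₃ s)

    SafeRealises : List ℕ → ℕ → ℕ → Set
    SafeRealises xs r ℓ = ∃[ s ] (Safe t s × Realises xs r ℓ s)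

    -- The table entry has the same kinds and level but weaker bounds, so the position also realises
    -- a state known to be `Safe`.
    cover : ∀ {xs r ℓ s} → Covers t s → Realises xs r ℓ s → SafeRealises xs r ℓ
    cover {s = s} cov R with find (code s) t in eq
    cover {s = s} (just {x = u} (refl , refl , a , b , c)) (realises re h fl b₁ b₂ b₃) | just _ =
      u , find-All (code s) t allSafe eq , realises re h fl (Bounded-mono a b₁) (Bounded-mono b b₂) (Bounded-mono c b₃)

    Trimmed : List ℕ → ℕ → State → Set
    Trimmed xs ℓ s = Bounded xs ℓ 1 (m₁ s) × Bounded xs ℓ 2 (m₂ s) × Bounded xs ℓ 3 (m₃ s)

    trimmed : ∀ {xs ℓ a b c} ks p → Bounded xs ℓ 1 a → Bounded xs ℓ 2 b → Bounded xs ℓ 3 c → Trimmed xs ℓ (trim ks p a b c)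
    trimmed {xs} {ℓ} ks p b₁ b₂ b₃ = d₁ , d₂ , Bounded-⊓ b₃ (far′ d₂)
      where d₁ = Bounded-⊓ b₁ (far {m = 0} trivial ≤-refl)
            d₂ = Bounded-⊓ b₂ (far′ d₁)

    tops : ∀ {xs ℓ} ks p → Trimmed xs ℓ (state ks p 4 8 12)
    tops ks p = far {m = 0} trivial ≤-refl , far′ (far {m = 0} trivial ≤-refl) , far′ (far′ (far {m = 0} trivial ≤-refl))

    -- `exact` is the cut inequality at r and c. A `far` step adds one column, which costs i + 1 ≤ 4
    -- on the left and gains 4 on the right.
    Bounded-promise : ∀ {x xs r ℓ p j m} → drop r parts ≡ x ∷ xs → r + ℓ ≡ n + p → Bounded (x ∷ xs) ℓ j m → Promise p j m
    Bounded-promise eq h trivial i = ≤-trans (≤-reflexive (*-zeroʳ (suc (toℕ i)))) z≤n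
    Bounded-promise {p = p} {m = m′} eq h (far {j} {m} b le) i = begin
      I * suc j                  ≡⟨ *-suc I j ⟩
      I + I * j                  ≤⟨ +-mono-≤ (Fin.toℕ<n i) (Bounded-promise eq h b i) ⟩
      4 + (m + I * p + loss l i)   ≡⟨ lem m (I * p) (loss l i) ⟩
      m + 4 + I * p + loss l i     ≤⟨ +-monoˡ-≤ (loss l i) (+-monoˡ-≤ (I * p) le) ⟩
      m′ + I * p + loss l i        ∎
      where open ≤-Reasoning
            I = suc (toℕ i)
            lem : ∀ a b c → 4 + (a + b + c) ≡ a + 4 + b + c
            lem = solve-∀
    Bounded-promise {r = r} {p = p} {j} {m} eq h (exact c refl le) i = +-cancelˡ-≤ (I * n) _ _ (begin
      I * n + I * j              ≤⟨ +-monoˡ-≤ (I * j) (cut i r c) ⟩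
      I * (r + c) + outside (drop r parts) c + loss l i + I * j
        ≤⟨ +-monoˡ-≤ (I * j) (+-monoˡ-≤ (loss l i) (+-monoʳ-≤ (I * (r + c)) (subst (λ ys → outside ys c ≤ m) (sym eq) le))) ⟩
      I * (r + c) + m + loss l i + I * j  ≡⟨ lem I r c j m (loss l i) ⟩
      I * (r + (c + j)) + m + loss l i    ≡⟨ cong (λ z → I * z + m + loss l i) h ⟩
      I * (n + p) + m + loss l i   ≡⟨ lem′ I n p m (loss l i) ⟩
      I * n + (m + I * p + loss l i)  ∎)
      where open ≤-Reasoning
            I = suc (toℕ i)
            lem : ∀ I r c j m k → I * (r + c) + m + k + I * j ≡ I * (r + (c + j)) + m + k
            lem = solve-∀
            lem′ : ∀ I n p m k → I * (n + p) + m + k ≡ I * n + (m + I * p + k)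
            lem′ = solve-∀

    widened : ∀ {r ℓ ks E} → HasKinds r ℓ ks E → HasKinds r (suc ℓ) (insert full ks) E
    widened (T , refl , b) with T′ , eq , p ← ↭-map-inv proj₁ {xs = (full , _) ∷ T} (↭-sym (insert-↭ full (map proj₁ T))) =
      T′ , sym eq , permute p (widen b)

    goRight : ∀ {xs r ℓ s} → level s < cap → Realises xs r ℓ s → Realises xs r (suc ℓ) (right s)
    goRight {xs} {r} {ℓ} {state ks p a b c} p<cap (realises re h fl b₁ b₂ b₃)
      with c₁ , c₂ , c₃ ← trimmed (insert full ks) (suc p) (Bounded-right {m = 0} (fl p<cap) trivial)
                                  (Bounded-right (fl p<cap) b₁) (Bounded-right (fl p<cap) b₂) =
      realises (widened re) (trans (+-suc r ℓ) (trans (cong suc h) (sym (+-suc n p))))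
        (λ _ → n≤0⇒n≡0 (≤-trans (outside-antimono xs (n≤1+n ℓ)) (≤-reflexive (fl p<cap)))) c₁ c₂ c₃

    Ready : List ℕ → ℕ → ℕ → Set
    Ready xs r x = ∃[ ℓ ] (ℓ ≤ x × ∃[ s ] (Safe t s × Realises xs r ℓ s × (ℓ ≡ x ⊎ ¬ (level s < cap))))

    extend : ∀ fuel {xs r ℓ x} → x ≤ fuel + ℓ → ℓ ≤ x → SafeRealises xs r ℓ → Ready xs r x
    extend fuel {ℓ = ℓ} {x} le ℓ≤x (s , sf , R) with ℓ ≟ x | level s <? cap
    ... | yes eq | _     = ℓ , ℓ≤x , s , sf , R , inj₁ eq
    ... | no  _  | no ¬p = ℓ , ℓ≤x , s , sf , R , inj₂ ¬p
    extend zero le ℓ≤x (s , sf , R) | no ℓ≢x | yes p = contradiction (≤-antisym ℓ≤x le) ℓ≢x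
    extend (suc fuel) {x = x} le ℓ≤x (s , sf , R) | no ℓ≢x | yes p =
      extend fuel (subst (x ≤_) (sym (+-suc fuel _)) le) (≤∧≢⇒< ℓ≤x ℓ≢x) (cover (Safe.→right sf p) (goRight p R))

    module _ {xs : List ℕ} {r x : ℕ} (eq : drop r parts ≡ x ∷ xs) (r≡x : entry parts r ≡ x) (xs≤x : All (_≤ x) xs) where

      -- Cutting with r rows and x columns leaves nothing outside, as later rows have length at most
      -- x.
      inStaircase : n ≤ r + x
      inStaircase = begin
        n                                       ≡⟨ *-identityˡ n ⟨
        1 * n                                   ≤⟨ cut 0F r x ⟩
        1 * (r + x) + outside (drop r parts) x + lookup l 0F
          ≡⟨ cong₂ (λ o k → 1 * (r + x) + o + k) (trans (cong (λ ys → outside ys x) eq) (outside-≤ (x ∷ xs) (≤-refl ∷ xs≤x))) l₀ ⟩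
        1 * (r + x) + 0 + 0                     ≡⟨ lem (r + x) ⟩
        r + x                                   ∎
        where open ≤-Reasoning
              lem : ∀ y → 1 * y + 0 + 0 ≡ y
              lem = solve-∀

      0<level : ∀ {p} → suc r + x ≡ n + p → 0 < p
      0<level {p} h = +-cancelˡ-< n 0 p (subst₂ _<_ (sym (+-identityʳ n)) h (s≤s inStaircase))

      lower : ∀ {p} → suc r + x ≡ n + p → r + x ≡ n + pred p
      lower {zero}  h = contradiction (0<level h) λ ()
      lower {suc p} h = suc-injective (trans h (+-suc n p))

      possible : ∀ {s} → Realises xs (suc r) x s → Possible s
      possible (realises _ h _ b₁ b₂ b₃) = 0<level h ,
        Bounded-promise eq (lower h) (Bounded-up b₁) ,
        Bounded-promise eq (lower h) (Bounded-up b₂) ,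
        Bounded-promise eq (lower h) (Bounded-up b₃)

      goUp : ∀ {s} → Safe t s → Realises xs (suc r) x s → SafeRealises (x ∷ xs) r x
      goUp {s} sf R@(realises re h fl b₁ b₂ b₃) with move s | Safe.→up sf (possible R)
      ... | just (ks , f) | just cov
        with c₁ , c₂ , c₃ ← trimmed ks (pred (level s)) (Bounded-up b₁) (Bounded-up b₂) (Bounded-up b₃) =
        cover cov (realises (proj₂ (row-sound f (≤-reflexive (sym r≡x)) re)) (lower h)
          (λ _ → outside-≤ (x ∷ xs) (≤-refl ∷ xs≤x)) c₁ c₂ c₃)

      -- Only the first ℓ columns of the row are used. One row fewer above and one column more keep
      -- the level; boxes of the new column in processed rows stay blank.
      goOver : ∀ {ℓ s} → ℓ < x → ¬ (level s < cap) → Safe t s → Realises xs (suc r) ℓ s → SafeRealises (x ∷ xs) r (suc ℓ)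
      goOver {ℓ} {s} ℓ<x ¬p sf (realises re h fl b₁ b₂ b₃) with move s | Safe.→over sf ¬p
      ... | just (ks , f) | just cov with c₁ , c₂ , c₃ ← tops {x ∷ xs} {suc ℓ} ks (level s) =
        cover cov (realises (widened (proj₂ (row-sound f (subst (ℓ ≤_) (sym r≡x) (<⇒≤ ℓ<x)) re)))
          (trans (+-suc r ℓ) h) (λ p → contradiction p ¬p) c₁ c₂ c₃)

      goRow : Ready xs (suc r) x → ∃[ ℓ ] (ℓ ≤ x × SafeRealises (x ∷ xs) r ℓ)
      goRow (ℓ , ℓ≤x , s , sf , R , inj₁ refl) = _ , ≤-refl , goUp sf R
      goRow (ℓ , ℓ≤x , s , sf , R , inj₂ ¬p) with m≤n⇒m<n∨m≡n ℓ≤x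
      ... | inj₁ ℓ<x  = suc ℓ , ℓ<x , goOver ℓ<x ¬p sf R
      ... | inj₂ refl = _ , ≤-refl , goUp sf R

    begun : ∀ {xs r p} → p ≤ cap → r ≡ n + p → (p < cap → outside xs 0 ≡ 0) → SafeRealises xs r 0
    begun {xs} {r} {p} p≤ eq fl with c₁ , c₂ , c₃ ← tops {xs} {0} [] p =
      cover (started p p≤) (realises ([] , refl , empty r) (trans (+-identityʳ r) eq) fl c₁ c₂ c₃)

    -- Rows with index n + cap or more are left blank.
    run : ∀ xs r → drop r parts ≡ xs → AllPairs _≥_ xs → n ≤ length xs + r → r ≤ n + cap →
          ∃[ ℓ ] (ℓ ≤ entry xs 0 × SafeRealises xs r ℓ)
    -- All rows lie above index r, so play starts with no column at level r - n.
    run [] r eq _ n≤r r≤ = 0 , z≤n , begun (m≤n+o⇒m∸n≤o r n r≤) (sym (m+[n∸m]≡n n≤r)) (λ _ → refl)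
    run (x ∷ xs) r eq (x≥ ∷ xs≥) n≤r r≤ with suc r ≤? n + cap
    ... | no r≮ = 0 , z≤n , begun ≤-refl (≤-antisym r≤ (≮⇒≥ r≮)) (λ c<c → contradiction c<c (<-irrefl refl))
    ... | yes r< with r≡ , eq′ ← drop-∷ r parts eq
                  with ℓ , ℓ≤ , R ← run xs (suc r) eq′ xs≥ (subst (n ≤_) (sym (+-suc (length xs) r)) n≤r) r< =
      goRow eq r≡ x≥ (extend x (m≤m+n x ℓ) (≤-trans ℓ≤ (head≤ x≥)) R)
      where head≤ : ∀ {ys} → All (_≤ x) ys → entry ys 0 ≤ x
            head≤ []        = z≤n
            head≤ (y≤x ∷ _) = y≤x

    -- At r = 0, `height` reads ℓ = n + `level s`, and the level cancels between `count` and
    -- `within`.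
    marks : AllPairs _≥_ parts → n ≤ length parts →
            ∃[ E ] (AllPairs Compatible E × All (λ e → atCol e < entry parts (atRow e)) E ×
                    ∀ k → n ≤ placed k E + lookup l k)
    marks parts≥ n≤ with ℓ , _ , s , sf , realises {E} (T , refl , b) h _ _ _ _ ←
      run parts 0 refl parts≥ (subst (n ≤_) (sym (+-identityʳ _)) n≤) z≤n =
      E , Board.compatible b , All.map (proj₂ ∘ proj₂) (Board.inside b) , λ k → +-cancelʳ-≤ (level s) n _ (begin
        n + level s                               ≡⟨ h ⟨
        ℓ                                         ≤⟨ Board.count b k ⟩
        placed k E + free# k (kinds s)            ≤⟨ +-monoʳ-≤ (placed k E) (Safe.within sf k) ⟩
        placed k E + (level s + lookup l k)       ≡⟨ lem (placed k E) (level s) (lookup l k) ⟩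
        placed k E + lookup l k + level s         ∎)
      where open ≤-Reasoning
            lem : ∀ a b c → a + (b + c) ≡ a + c + b
            lem = solve-∀

-- Vertices and weak duality

lookup-injective : ∀ {A : Set} {xs : List A} → Unique xs → ∀ i j → List.lookup xs i ≡ List.lookup xs j → i ≡ j
lookup-injective (_ ∷ _)   zero    zero    eq = refl
lookup-injective (x≢ ∷ _)  zero    (suc j) eq = contradiction eq (All.lookup x≢ (∈-lookup j))
lookup-injective (x≢ ∷ _)  (suc i) zero    eq = contradiction (sym eq) (All.lookup x≢ (∈-lookup i))
lookup-injective (_ ∷ xs≢) (suc i) (suc j) eq = cong suc (lookup-injective xs≢ i j eq)

∈⇒↭ : ∀ {A : Set} {x : A} {xs} → x List.∈ xs → ∃[ ys ] xs ↭ x ∷ ys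
∈⇒↭ x∈ with ys , zs , refl ← ∈-∃++ x∈ = ys ++ zs , shift _ ys zs

-- The partner of the head can be removed from `ys`, since no other element of `xs` can be matched
-- to it.
matching-length : ∀ {A B : Set} {R : A → B → Set} {xs ys} → AllPairs (λ x x′ → ∀ y → R x y → ¬ R x′ y) xs →
                  All (λ x → ∃[ y ] (R x y × y List.∈ ys)) xs → length xs ≤ length ys
matching-length []           []                     = z≤n
matching-length {R = R} {x ∷ xs} {ys} (x# ∷ xs#) ((y , Rxy , y∈) ∷ all) with zs , p ← ∈⇒↭ y∈ =
  ≤-trans (s≤s (matching-length xs# (All.zipWith avoid (x# , all)))) (≤-reflexive (sym (↭-length p)))
  where
  avoid : ∀ {x′} → (∀ y → R x y → ¬ R x′ y) × (∃[ y ] (R x′ y × y List.∈ ys)) → ∃[ y ] (R x′ y × y List.∈ zs)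
  avoid (x#x′ , y′ , Rx′y′ , y′∈) with ∈-resp-↭ p y′∈
  ... | here refl   = contradiction Rx′y′ (x#x′ _ Rxy)
  ... | there y′∈zs = y′ , Rx′y′ , y′∈zs

elements : ∀ {n} → Subset n → List (Fin n)
elements []            = []
elements (true  ∷ p) = zero ∷ map suc (elements p)
elements (false ∷ p) = map suc (elements p)

length-elements : ∀ {n} (p : Subset n) → length (elements p) ≡ ∣ p ∣
length-elements []            = refl
length-elements (true  ∷ p) = cong suc (trans (length-map suc (elements p)) (length-elements p))
length-elements (false ∷ p) = trans (length-map suc (elements p)) (length-elements p)

elements-unique : ∀ {n} (p : Subset n) → Unique (elements p)
elements-unique []            = []
elements-unique (true  ∷ p) = All.map⁺ (All.universal (λ _ ()) _) ∷ Unique.map⁺ Fin.suc-injective (elements-unique p)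
elements-unique (false ∷ p) = Unique.map⁺ Fin.suc-injective (elements-unique p)

∈-elements⁻ : ∀ {n} (p : Subset n) → All (_∈ p) (elements p)
∈-elements⁻ []            = []
∈-elements⁻ (true  ∷ p) = Vec.here ∷ All.map⁺ (All.map Vec.there (∈-elements⁻ p))
∈-elements⁻ (false ∷ p) = All.map⁺ (All.map Vec.there (∈-elements⁻ p))

∈-elements⁺ : ∀ {n x} (p : Subset n) → x ∈ p → x List.∈ elements p
∈-elements⁺ (true  ∷ p) Vec.here      = here refl
∈-elements⁺ (true  ∷ p) (Vec.there x) = there (∈-map⁺ suc (∈-elements⁺ p x))
∈-elements⁺ (false ∷ p) (Vec.there x) = ∈-map⁺ suc (∈-elements⁺ p x)

length-cartesianProduct : ∀ {A B : Set} (xs : List A) (ys : List B) → length (cartesianProduct xs ys) ≡ length xs * length ys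
length-cartesianProduct []       ys = refl
length-cartesianProduct (x ∷ xs) ys = trans (length-++ (map (x ,_) ys)) (cong₂ _+_ (length-map (x ,_) ys) (length-cartesianProduct xs ys))

x∈⋃⁻ : ∀ {n x i} (Ss : Vec (Subset n) i) → x ∈ ⋃ (toList Ss) → ∃[ k ] x ∈ lookup Ss k
x∈⋃⁻ []       x∈ = contradiction x∈ ∉⊥
x∈⋃⁻ (S ∷ Ss) x∈ with x∈p∪q⁻ S (⋃ (toList Ss)) x∈
... | inj₁ x∈S = 0F , x∈S
... | inj₂ x∈⋃ with k , x∈k ← x∈⋃⁻ Ss x∈⋃ = suc k , x∈k

entry-lookup : ∀ xs (i : Fin (length xs)) → entry xs (toℕ i) ≡ List.lookup xs i
entry-lookup (x ∷ xs) zero    = refl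
entry-lookup (x ∷ xs) (suc i) = entry-lookup xs i

entry-positive : ∀ xs r {c} → c < entry xs r → r < length xs
entry-positive (x ∷ xs) zero    c<  = s≤s z≤n
entry-positive (x ∷ xs) (suc r) c<  = s≤s (entry-positive xs r c<)

cells : List ℕ → ℕ → ℕ → List (ℕ × ℕ)
cells []       r c = []
cells (x ∷ xs) r c = map (λ d → r , c + d) (upTo (x ∸ c)) ++ cells xs (suc r) c

length-cells : ∀ xs r c → length (cells xs r c) ≡ outside xs c
length-cells []       r c = refl
length-cells (x ∷ xs) r c = trans (length-++ (map _ (upTo (x ∸ c))))
  (cong₂ _+_ (trans (length-map _ (upTo (x ∸ c))) (length-upTo (x ∸ c))) (length-cells xs (suc r) c))

∈-cells : ∀ xs r c {d e} → c ≤ e → e < entry xs d → (r + d , e) List.∈ cells xs r c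
∈-cells (x ∷ xs) r c {zero}  {e} c≤e e<x = ∈-++⁺ˡ
  (subst₂ (λ a b → (a , b) List.∈ map (λ d → r , c + d) (upTo (x ∸ c))) (sym (+-identityʳ r)) (m+[n∸m]≡n c≤e)
    (∈-map⁺ (λ d → r , c + d) (∈-upTo⁺ (∸-monoˡ-< e<x c≤e))))
∈-cells (x ∷ xs) r c {suc d} {e} c≤e e<x = ∈-++⁺ʳ (map _ (upTo (x ∸ c)))
  (subst (λ a → (a , e) List.∈ cells xs (suc r) c) (sym (+-suc r d)) (∈-cells xs (suc r) c c≤e e<x))

entry-drop : ∀ (xs : List ℕ) r d → entry (drop r xs) d ≡ entry xs (r + d)
entry-drop xs       zero    d = refl
entry-drop []       (suc r) d = refl
entry-drop (x ∷ xs) (suc r) d = entry-drop xs r d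

module Diagram (μ : Partition) where
  open Partition μ

  graph : Graph
  graph = partitionGraph μ

  V : Set
  V = Graph.Vertex graph

  boxes-unique : Unique (boxes μ)
  boxes-unique = Unique.concat⁺
    (All.map⁺ (All.universal (λ r → Unique.map⁺ (λ { refl → refl }) (Unique.allFin⁺ _)) (allFin _)))
    (AllPairs.map⁺ (AllPairs.map (λ {r} {s} r≢s {b} (b∈r , b∈s) → apart r≢s b∈r b∈s) (Unique.allFin⁺ _)))
    where
    apart : ∀ {r s} → r ≢ s → ∀ {b : Box μ} → b List.∈ map (r ,_) (allFin (List.lookup parts r)) →
            ¬ (b List.∈ map (s ,_) (allFin (List.lookup parts s)))
    apart r≢s b∈r b∈s with _ , _ , refl ← ∈-map⁻ _ b∈r | _ , _ , refl ← ∈-map⁻ _ b∈s = r≢s refl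

  ∈-boxes : ∀ b → b List.∈ boxes μ
  ∈-boxes (r , c) = ∈-concatMap⁺ _ (Any.map (λ { refl → ∈-map⁺ (r ,_) (∈-allFin c) }) (∈-allFin r))

  position-injective : ∀ {u v} → row μ u ≡ row μ v → col μ u ≡ col μ v → u ≡ v
  position-injective {u} {v} r≡ c≡ = lookup-injective boxes-unique u v (box≡ (box μ u) (box μ v) r≡ c≡)
    where
    box≡ : ∀ (a b : Box μ) → toℕ (proj₁ a) ≡ toℕ (proj₁ b) → toℕ (proj₂ a) ≡ toℕ (proj₂ b) → a ≡ b
    box≡ (r , c) (s , d) r≡ c≡ with refl ← Fin.toℕ-injective r≡ with refl ← Fin.toℕ-injective {i = c} {d} c≡ = refl

  col<entry : ∀ v → col μ v < entry parts (row μ v)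
  col<entry v with r , c ← box μ v = subst (toℕ c <_) (sym (entry-lookup parts r)) (Fin.toℕ<n c)

  vertexAt : ∀ r c → c < entry parts r → ∃[ v ] (row μ v ≡ r × col μ v ≡ c)
  vertexAt r c c< with fromℕ< (entry-positive parts r c<) | Fin.toℕ-fromℕ< (entry-positive parts r c<)
  ... | i | refl with c<′ ← subst (c <_) (entry-lookup parts i) c< with b∈ ← ∈-boxes (i , fromℕ< c<′) =
    Any.index b∈ , cong (toℕ ∘ proj₁) (sym (Any.lookup-index b∈)) ,
    trans (cong (λ b → toℕ (proj₂ b)) (sym (Any.lookup-index b∈))) (Fin.toℕ-fromℕ< c<′)

  cost : ℕ → ℕ → ℕ → ℕ
  cost i r c = i * (r + c) + outside (drop r parts) c

  -- A box in a cut row or column is charged to that line paired with its stable set, every other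
  -- box to itself. A stable set meets a line at most once, so no target is charged twice.
  unionSize-≤-cost : ∀ {i k} → UnionSize graph i k → ∀ r c → k ≤ cost i r c
  unionSize-≤-cost {i} (Ss , (stable , _) , refl) r c = begin
    ∣ U ∣                ≡⟨ length-elements U ⟨
    length (elements U)  ≤⟨ matching-length {R = Hit} (AllPairs.map (λ {u} {v} u≢v → disjoint u≢v) (elements-unique U))
                              (All.map hits (∈-elements⁻ U)) ⟩
    length targets       ≡⟨ length-targets ⟩
    cost i r c           ∎
    where
    open ≤-Reasoning
    U = ⋃ (toList Ss)
    Target : Set
    Target = (Fin i × ℕ) ⊎ (Fin i × ℕ) ⊎ (ℕ × ℕ)
    Hit : V → Target → Set
    Hit v (inj₁ (k , s))        = v ∈ lookup Ss k × row μ v ≡ s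
    Hit v (inj₂ (inj₁ (k , d))) = v ∈ lookup Ss k × col μ v ≡ d
    Hit v (inj₂ (inj₂ (s , d))) = row μ v ≡ s × col μ v ≡ d
    disjoint : ∀ {u v} → u ≢ v → ∀ y → Hit u y → ¬ Hit v y
    disjoint u≢v (inj₁ (k , s))        (u∈ , refl) (v∈ , eq)  = VecAll.lookup stable (Vec∈-lookup k Ss) _ _ u∈ v∈ (u≢v , inj₁ (sym eq))
    disjoint u≢v (inj₂ (inj₁ (k , d))) (u∈ , refl) (v∈ , eq)  = VecAll.lookup stable (Vec∈-lookup k Ss) _ _ u∈ v∈ (u≢v , inj₂ (sym eq))
    disjoint u≢v (inj₂ (inj₂ (s , d))) (refl , refl) (eq , eq′) = u≢v (position-injective (sym eq) (sym eq′))
    rowTargets colTargets : List (Fin i × ℕ)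
    rowTargets = cartesianProduct (allFin i) (upTo r)
    colTargets = cartesianProduct (allFin i) (upTo c)
    boxTargets : List (ℕ × ℕ)
    boxTargets = cells (drop r parts) r c
    targets : List Target
    targets = map inj₁ rowTargets ++ map (inj₂ ∘ inj₁) colTargets ++ map (inj₂ ∘ inj₂) boxTargets
    length-product : ∀ m → length (cartesianProduct (allFin i) (upTo m)) ≡ i * m
    length-product m = trans (length-cartesianProduct (allFin i) (upTo m)) (cong₂ _*_ (length-tabulate {n = i} id) (length-upTo m))
    length-targets : length targets ≡ cost i r c
    length-targets = trans (length-++ (map inj₁ rowTargets)) (trans (cong₂ _+_ (trans (length-map _ rowTargets) (length-product r))
      (trans (length-++ (map (inj₂ ∘ inj₁) colTargets)) (cong₂ _+_ (trans (length-map _ colTargets) (length-product c))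
        (trans (length-map _ boxTargets) (length-cells (drop r parts) r c)))))
      (trans (sym (+-assoc (i * r) (i * c) _)) (cong (_+ outside (drop r parts) c) (sym (*-distribˡ-+ i r c)))))
    hits : ∀ {v} → v ∈ U → ∃[ y ] (Hit v y × y List.∈ targets)
    hits {v} v∈ with k , v∈k ← x∈⋃⁻ Ss v∈ with row μ v <? r | col μ v <? c
    ... | yes r< | _      = inj₁ (k , row μ v) , (v∈k , refl) ,
      ∈-++⁺ˡ (∈-map⁺ inj₁ (∈-cartesianProduct⁺ (∈-allFin k) (∈-upTo⁺ r<)))
    ... | no _   | yes c< = inj₂ (inj₁ (k , col μ v)) , (v∈k , refl) ,
      ∈-++⁺ʳ (map inj₁ rowTargets) (∈-++⁺ˡ (∈-map⁺ (inj₂ ∘ inj₁) (∈-cartesianProduct⁺ (∈-allFin k) (∈-upTo⁺ c<))))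
    ... | no r≮  | no c≮  = inj₂ (inj₂ (row μ v , col μ v)) , (refl , refl) ,
      ∈-++⁺ʳ (map inj₁ rowTargets) (∈-++⁺ʳ (map (inj₂ ∘ inj₁) colTargets) (∈-map⁺ (inj₂ ∘ inj₂) inBoxes))
      where
      r≤ = m+[n∸m]≡n (≮⇒≥ r≮)
      inBoxes : (row μ v , col μ v) List.∈ boxTargets
      inBoxes = subst (λ s → (s , col μ v) List.∈ boxTargets) r≤
        (∈-cells (drop r parts) r c (≮⇒≥ c≮)
          (subst (col μ v <_) (sym (trans (entry-drop parts r (row μ v ∸ r)) (cong (entry parts) r≤))) (col<entry v)))

-- Minimal cuts

-- abstract keeps the search for the minimum from being unfolded in later types.
abstract
  minimum : (f : ℕ × ℕ → ℕ) → (∀ r c → r + c ≤ f (r , c)) → ∃[ p ] ∀ q → f p ≤ f q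
  minimum f growing = best , minimal
    where
    range : List (ℕ × ℕ)
    range = cartesianProduct (upTo (suc (f (0 , 0)))) (upTo (suc (f (0 , 0))))
    best : ℕ × ℕ
    best = Extrema.argmin f (0 , 0) range
    minimal : ∀ q → f best ≤ f q
    -- `growing` confines the search: once r + c exceeds f (0 , 0), so does the value at (r , c).
    minimal (r , c) with r + c ≤? f (0 , 0)
    ... | yes le = All.lookup (Extrema.f[argmin]≤f[xs] {f = f} (0 , 0) range)
                     (∈-cartesianProduct⁺ (∈-upTo⁺ (s≤s (≤-trans (m≤m+n r c) le))) (∈-upTo⁺ (s≤s (≤-trans (m≤n+m c r) le))))
    ... | no ¬le = ≤-trans (Extrema.f[argmin]≤f[⊤] {f = f} (0 , 0) range) (≤-trans (<⇒≤ (≰⇒> ¬le)) (growing r c))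

module Cuts (parts : List ℕ) (parts≥ : AllPairs _≥_ parts) where

  cost : ℕ → ℕ → ℕ → ℕ
  cost i r c = i * (r + c) + outside (drop r parts) c

  -- A record, so that `i`, `r` and `c` can be inferred from a proof.
  record Minimal (i r c : ℕ) : Set where
    constructor minimal
    field minimality : ∀ r′ c′ → cost i r c ≤ cost i r′ c′
  open Minimal

  minimalCut : ∀ i → ∃[ r ] ∃[ c ] Minimal (suc i) r c
  minimalCut i with (r , c) , min ← minimum (λ (r , c) → cost (suc i) r c) (λ r c → ≤-trans (m≤n*m (r + c) (suc i)) (m≤m+n _ _)) =
    r , c , minimal λ r′ c′ → min (r′ , c′)

  cost-suc : ∀ i r c → cost (suc i) r c ≡ cost i r c + (r + c)
  cost-suc i r c = lem i (r + c) (outside (drop r parts) c)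
    where lem : ∀ i d o → suc i * d + o ≡ i * d + o + d
          lem = solve-∀

  module _ {n : ℕ} (n≤ : ∀ r c → n ≤ cost 1 r c) where

    -- While r + c ≤ n − i − 1 the next row meets the region outside the cut in more than
    -- i boxes, so it may as well join the cut.
    deepen : ∀ fuel i r c → Minimal (suc i) r c → n ≤ fuel + (r + c) →
             ∃[ r′ ] ∃[ c′ ] (Minimal (suc i) r′ c′ × n ≤ r′ + c′ + i)
    deepen fuel i r c min le with n ≤? r + c + i
    ... | yes n≤d = r , c , min , n≤d
    deepen zero i r c min le | no n≰d = contradiction (≤-trans le (m≤m+n (r + c) i)) n≰d
    deepen (suc fuel) i r c min le | no n≰d =
      deepen fuel i (suc r) c (minimal λ r′ c′ → ≤-trans shorter (minimality min r′ c′))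
        (subst (n ≤_) (sym (+-suc fuel (r + c))) le)
      where
      open ≤-Reasoning
      d<n : r + c + i < n
      d<n = ≰⇒> n≰d
      go : ∀ ys → drop r parts ≡ ys → suc i * (suc r + c) + outside (drop (suc r) parts) c ≤ suc i * (r + c) + outside ys c
      go [] eq = contradiction (≤-<-trans (m≤m+n (r + c) i) d<n) (≤⇒≯ (begin
        n                                  ≤⟨ n≤ r c ⟩
        1 * (r + c) + outside (drop r parts) c  ≡⟨ cong (λ ys → 1 * (r + c) + outside ys c) eq ⟩
        1 * (r + c) + 0                    ≡⟨ trans (+-identityʳ _) (*-identityˡ (r + c)) ⟩
        r + c                              ∎))
      go (x ∷ xs) eq with x≥ ∷ _ ← subst (AllPairs _≥_) eq (AllPairs.drop⁺ r parts≥) = begin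
        suc i * (suc r + c) + outside (drop (suc r) parts) c
          ≡⟨ cong (λ ys → suc i * (suc r + c) + outside ys c) (proj₂ (drop-∷ r parts eq)) ⟩
        suc i * (suc r + c) + outside xs c        ≡⟨ lem i (r + c) (outside xs c) ⟩
        suc i * (r + c) + (suc i + outside xs c)  ≤⟨ +-monoʳ-≤ (suc i * (r + c)) (+-monoˡ-≤ (outside xs c) long) ⟩
        suc i * (r + c) + (x ∸ c + outside xs c)  ∎
        where
        lem : ∀ i d o → suc i * suc d + o ≡ suc i * d + (suc i + o)
        lem = solve-∀
        lem′ : ∀ r i c → r + (suc i + c) ≡ suc (r + c + i)
        lem′ = solve-∀
        n≤r+x : n ≤ r + x
        n≤r+x = begin
          n                                       ≤⟨ n≤ r x ⟩
          1 * (r + x) + outside (drop r parts) x  ≡⟨ cong (λ ys → 1 * (r + x) + outside ys x) eq ⟩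
          1 * (r + x) + outside (x ∷ xs) x        ≡⟨ cong (1 * (r + x) +_) (outside-≤ (x ∷ xs) (≤-refl ∷ x≥)) ⟩
          1 * (r + x) + 0                         ≡⟨ trans (+-identityʳ _) (*-identityˡ (r + x)) ⟩
          r + x                                   ∎
        long : suc i ≤ x ∸ c
        long = m+n≤o⇒m≤o∸n (suc i) (+-cancelˡ-≤ r _ _ (begin
          r + (suc i + c)   ≡⟨ lem′ r i c ⟩
          suc (r + c + i)   ≤⟨ d<n ⟩
          n                 ≤⟨ n≤r+x ⟩
          r + x             ∎))
      shorter : cost (suc i) (suc r) c ≤ cost (suc i) r c
      shorter = go (drop r parts) refl

  -- `tight` and `below` together say that the minimal cost for i sets is i n minus the loss.
  -- `below` feeds the game as `cut`; `tight` yields the upper bound on α.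
  record Budget : Set where
    field
      n l₂ l₃ l₄ : ℕ
      l₂≤1 : l₂ ≤ 1
      l₃≤2 : l₃ ≤ 2
      l₄≤3 : l₄ ≤ 3
      l₂≤l₃ : l₂ ≤ l₃
      l₃≤l₄ : l₃ ≤ l₄
    budget : Vec ℕ 4
    budget = 0 ∷ l₂ ∷ l₃ ∷ l₄ ∷ []
    field
      tight : ∀ i → ∃[ r ] ∃[ c ] suc (toℕ i) * n ≡ cost (suc (toℕ i)) r c + loss budget i
      below : ∀ i r c → suc (toℕ i) * n ≤ cost (suc (toℕ i)) r c + loss budget i

  module _ {i r c r′ c′ : ℕ} (min : Minimal (suc i) r c) (min′ : Minimal (suc (suc i)) r′ c′) where

    gain : ℕ
    gain = cost (suc (suc i)) r′ c′ ∸ cost (suc i) r c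

    private
      lower : cost (suc i) r c + (r′ + c′) ≤ cost (suc (suc i)) r′ c′
      lower = ≤-trans (+-monoˡ-≤ (r′ + c′) (minimality min r′ c′)) (≤-reflexive (sym (cost-suc (suc i) r′ c′)))

    cost+gain : cost (suc i) r c + gain ≡ cost (suc (suc i)) r′ c′
    cost+gain = m+[n∸m]≡n {cost (suc i) r c} (≤-trans (m≤m+n _ (r′ + c′)) lower)

    -- For a fixed cut the cost grows by r + c per stable set. Comparing each minimal cut with the
    -- other's cost gives r′ + c′ ≤ `gain` ≤ r + c, so successive gains decrease.
    gain≤ : gain ≤ r + c
    gain≤ = m≤n+o⇒m∸n≤o (cost (suc (suc i)) r′ c′) (cost (suc i) r c)
      (≤-trans (minimality min′ r c) (≤-reflexive (cost-suc (suc i) r c)))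

    ≤gain : r′ + c′ ≤ gain
    ≤gain = m+n≤o⇒m≤o∸n (r′ + c′) {cost (suc i) r c} (subst (_≤ cost (suc (suc i)) r′ c′) (+-comm _ (r′ + c′)) lower)

  Deep : ℕ → ℕ → Set
  Deep n i = ∃[ r ] ∃[ c ] (Minimal (suc i) r c × n ≤ r + c + i)

  deepCut : ∀ {r c} → Minimal 1 r c → ∀ i → Deep (cost 1 r c) i
  deepCut {r₁} {c₁} min₁ i with r , c , min ← minimalCut i = deepen (minimality min₁) (cost 1 r₁ c₁) i r c min (m≤m+n _ (r + c))

  -- Each lⱼ is n minus the j-th gain. The depth of the j-th cut makes that gain at least n - (j -
  -- 1), and decreasing gains make the lⱼ increase.
  budgetFrom : ∀ {r₁ c₁} (min₁ : Minimal 1 r₁ c₁) → Deep (cost 1 r₁ c₁) 1 → Deep (cost 1 r₁ c₁) 2 → Deep (cost 1 r₁ c₁) 3 → Budget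
  budgetFrom {r₁} {c₁} min₁ (r₂ , c₂ , min₂ , deep₂) (r₃ , c₃ , min₃ , deep₃) (r₄ , c₄ , min₄ , deep₄) = record
    { n = n ; l₂ = n ∸ e₂ ; l₃ = n ∸ e₃ ; l₄ = n ∸ e₄
    ; l₂≤1 = short e₂ (≤-trans deep₂ (+-monoˡ-≤ 1 (≤gain min₁ min₂)))
    ; l₃≤2 = short e₃ (≤-trans deep₃ (+-monoˡ-≤ 2 (≤gain min₂ min₃)))
    ; l₄≤3 = short e₄ (≤-trans deep₄ (+-monoˡ-≤ 3 (≤gain min₃ min₄)))
    ; l₂≤l₃ = ∸-monoʳ-≤ n e₃≤e₂
    ; l₃≤l₄ = ∸-monoʳ-≤ n e₄≤e₃
    ; tight = λ { 0F → r₁ , c₁ , u₁ ; 1F → r₂ , c₂ , u₂ ; 2F → r₃ , c₃ , u₃ ; 3F → r₄ , c₄ , u₄ }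
    ; below = λ { 0F r c → ≤-trans (≤-reflexive u₁) (+-monoˡ-≤ _ (minimality min₁ r c))
                ; 1F r c → ≤-trans (≤-reflexive u₂) (+-monoˡ-≤ _ (minimality min₂ r c))
                ; 2F r c → ≤-trans (≤-reflexive u₃) (+-monoˡ-≤ _ (minimality min₃ r c))
                ; 3F r c → ≤-trans (≤-reflexive u₄) (+-monoˡ-≤ _ (minimality min₄ r c)) }
    }
    where
    n e₂ e₃ e₄ : ℕ
    n  = cost 1 r₁ c₁
    e₂ = gain min₁ min₂
    e₃ = gain min₂ min₃
    e₄ = gain min₃ min₄
    short : ∀ e {i} → n ≤ e + i → n ∸ e ≤ i
    short e = m≤n+o⇒m∸n≤o n e
    e₂≤n : e₂ ≤ n
    e₂≤n = ≤-trans (gain≤ min₁ min₂) (≤-trans (≤-reflexive (sym (*-identityˡ (r₁ + c₁)))) (m≤m+n _ _))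
    e₃≤e₂ : e₃ ≤ e₂
    e₃≤e₂ = ≤-trans (gain≤ min₂ min₃) (≤gain min₁ min₂)
    e₄≤e₃ : e₄ ≤ e₃
    e₄≤e₃ = ≤-trans (gain≤ min₃ min₄) (≤gain min₂ min₃)
    next : ∀ {i u v e k} → i * n ≡ u + k → u + e ≡ v → e ≤ n → suc i * n ≡ v + (k + (n ∸ e))
    next {i} {u} {v} {e} {k} eq refl e≤n = trans (cong₂ _+_ (sym (m+[n∸m]≡n e≤n)) eq) (lem e (n ∸ e) u k)
      where lem : ∀ e f u k → e + f + (u + k) ≡ u + e + (k + f)
            lem = solve-∀
    u₁ : 1 * n ≡ cost 1 r₁ c₁ + 0
    u₁ = trans (*-identityˡ n) (sym (+-identityʳ n))
    u₂ : 2 * n ≡ cost 2 r₂ c₂ + (n ∸ e₂)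
    u₂ = next {1} {cost 1 r₁ c₁} {k = 0} u₁ (cost+gain min₁ min₂) e₂≤n
    u₃ : 3 * n ≡ cost 3 r₃ c₃ + (n ∸ e₂ + (n ∸ e₃))
    u₃ = next {2} {cost 2 r₂ c₂} {k = n ∸ e₂} u₂ (cost+gain min₂ min₃) (≤-trans e₃≤e₂ e₂≤n)
    u₄ : 4 * n ≡ cost 4 r₄ c₄ + (n ∸ e₂ + (n ∸ e₃) + (n ∸ e₄))
    u₄ = next {3} {cost 3 r₃ c₃} {k = n ∸ e₂ + (n ∸ e₃)} u₃ (cost+gain min₃ min₄) (≤-trans e₄≤e₃ (≤-trans e₃≤e₂ e₂≤n))

  budgetOf : Budget
  budgetOf with _ , _ , min₁ ← minimalCut 0 = budgetFrom min₁ (deepCut min₁ 1) (deepCut min₁ 2) (deepCut min₁ 3)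

-- Shapes and chromatic differences

topSum : ℕ → List ℕ → ℕ
topSum zero    _        = 0
topSum (suc i) []       = 0
topSum (suc i) (x ∷ xs) = x + topSum i xs

topSum-suc : ∀ i xs → topSum (suc i) xs ≡ topSum i xs + entry xs i
topSum-suc zero    []       = refl
topSum-suc zero    (x ∷ xs) = +-identityʳ x
topSum-suc (suc i) []       = refl
topSum-suc (suc i) (x ∷ xs) = trans (cong (x +_) (topSum-suc i xs)) (sym (+-assoc x _ _))

excess : ℕ → List ℕ → ℕ
excess t = sum ∘ map (_∸ t)

topSum-≤-excess : ∀ t i xs → topSum i xs ≤ i * t + excess t xs
topSum-≤-excess t zero    xs       = z≤n
topSum-≤-excess t (suc i) []       = z≤n
topSum-≤-excess t (suc i) (x ∷ xs) = begin
  x + topSum i xs                           ≤⟨ +-mono-≤ (m≤n+m∸n x t) (topSum-≤-excess t i xs) ⟩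
  t + (x ∸ t) + (i * t + excess t xs)       ≡⟨ lem t (x ∸ t) (i * t) (excess t xs) ⟩
  t + i * t + (x ∸ t + excess t xs)         ∎
  where open ≤-Reasoning
        lem : ∀ a b c d → a + b + (c + d) ≡ a + c + (b + d)
        lem = solve-∀

excess-≤-topSum : ∀ i {xs} → AllPairs _≥_ xs → i * entry xs i + excess (entry xs i) xs ≤ topSum i xs
excess-≤-topSum zero    {[]}     []           = z≤n
excess-≤-topSum zero    {x ∷ xs} (x≥ ∷ xs≥)   = ≤-reflexive (outside-≤ (x ∷ xs) (≤-refl ∷ x≥))
excess-≤-topSum (suc i) {[]}     []           = ≤-reflexive (trans (+-identityʳ _) (*-zeroʳ i))
excess-≤-topSum (suc i) {x ∷ xs} (x≥ ∷ xs≥)   = begin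
  t + i * t + (x ∸ t + excess t xs)    ≡⟨ lem t (i * t) (x ∸ t) (excess t xs) ⟩
  t + (x ∸ t) + (i * t + excess t xs)  ≡⟨ cong (_+ (i * t + excess t xs)) (m+[n∸m]≡n (entry≤ i x≥)) ⟩
  x + (i * t + excess t xs)            ≤⟨ +-monoʳ-≤ x (excess-≤-topSum i xs≥) ⟩
  x + topSum i xs                      ∎
  where
  open ≤-Reasoning
  t = entry xs i
  lem : ∀ a b c d → a + b + (c + d) ≡ a + c + (b + d)
  lem = solve-∀
  entry≤ : ∀ i {ys} → All (_≤ x) ys → entry ys i ≤ x
  entry≤ zero    []         = z≤n
  entry≤ (suc i) []         = z≤n
  entry≤ zero    (y≤ ∷ _)   = y≤
  entry≤ (suc i) (_ ∷ ys≤)  = entry≤ i ys≤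

-- Each element of `xs` claims its own occurrence in `ys`; the second alternative admits colours
-- that no box has.
sum-map-≤ : ∀ {A : Set} (g : A → ℕ) {xs ys} → Unique xs → All (λ x → x List.∈ ys ⊎ g x ≡ 0) xs → sum (map g xs) ≤ sum (map g ys)
sum-map-≤ g []           []                 = z≤n
sum-map-≤ g (_ ∷ xs≢)    (inj₂ gx≡0 ∷ all) rewrite gx≡0 = sum-map-≤ g xs≢ all
sum-map-≤ g {x ∷ xs} {ys} (x≢ ∷ xs≢) (inj₁ x∈ ∷ all) with zs , p ← ∈⇒↭ x∈ =
  ≤-trans (+-monoʳ-≤ (g x) (sum-map-≤ g xs≢ (All.zipWith keep (x≢ , all)))) (≤-reflexive (sym (sum-↭ (map⁺ g p))))
  where
  keep : ∀ {y} → x ≢ y × (y List.∈ ys ⊎ g y ≡ 0) → y List.∈ zs ⊎ g y ≡ 0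
  keep (x≢y , inj₂ gy≡0) = inj₂ gy≡0
  keep (x≢y , inj₁ y∈) with ∈-resp-↭ p y∈
  ... | here refl  = contradiction refl x≢y
  ... | there y∈zs = inj₁ y∈zs

-- With t the entry at i of the decreasing list s, the sum of the first i entries of s is
-- i t + Σ (x ∸ t), and i t + Σ (x ∸ t) bounds the sum of any i entries from above.
topSum-domination : ∀ {A : Set} (g : A → ℕ) {ks us s} → AllPairs _≥_ s → s ↭ map g us → Unique ks →
                    All (λ k → k List.∈ us ⊎ g k ≡ 0) ks → ∀ i → topSum i (map g ks) ≤ topSum i s
topSum-domination g {ks} {us} {s} s≥ p ks≢ all i = begin
  topSum i (map g ks)               ≤⟨ topSum-≤-excess t i (map g ks) ⟩
  i * t + excess t (map g ks)       ≡⟨ cong (λ xs → i * t + sum xs) (map-∘ ks) ⟨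
  i * t + sum (map (λ k → g k ∸ t) ks)  ≤⟨ +-monoʳ-≤ (i * t) (sum-map-≤ (λ k → g k ∸ t) ks≢ (All.map small all)) ⟩
  i * t + sum (map (λ k → g k ∸ t) us)  ≡⟨ cong (λ xs → i * t + sum xs) (map-∘ us) ⟩
  i * t + excess t (map g us)       ≡⟨ cong (i * t +_) (sum-↭ (map⁺ (_∸ t) p)) ⟨
  i * t + excess t s                ≤⟨ excess-≤-topSum i s≥ ⟩
  topSum i s                        ∎
  where
  open ≤-Reasoning
  t = entry s i
  small : ∀ {k} → k List.∈ us ⊎ g k ≡ 0 → k List.∈ us ⊎ g k ∸ t ≡ 0
  small (inj₁ k∈)   = inj₁ k∈
  small (inj₂ gk≡0) = inj₂ (trans (cong (_∸ t) gk≡0) (0∸n≡0 t))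

∣p∪q∣≡∣p∣+∣q∣ : ∀ {n} (p q : Subset n) → Empty (p ∩ q) → ∣ p ∪ q ∣ ≡ ∣ p ∣ + ∣ q ∣
∣p∪q∣≡∣p∣+∣q∣ []          []          _ = refl
∣p∪q∣≡∣p∣+∣q∣ (false ∷ p) (false ∷ q) e = ∣p∪q∣≡∣p∣+∣q∣ p q (drop-∷-Empty e)
∣p∪q∣≡∣p∣+∣q∣ (true  ∷ p) (false ∷ q) e = cong suc (∣p∪q∣≡∣p∣+∣q∣ p q (drop-∷-Empty e))
∣p∪q∣≡∣p∣+∣q∣ (false ∷ p) (true  ∷ q) e = trans (cong suc (∣p∪q∣≡∣p∣+∣q∣ p q (drop-∷-Empty e))) (sym (+-suc ∣ p ∣ ∣ q ∣))
∣p∪q∣≡∣p∣+∣q∣ (true  ∷ p) (true  ∷ q) e = contradiction (zero , Vec.here) e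

α-0 : ∀ G → α G 0 ≡ 0
α-0 G with proj₁ (proj₂ (α-exists G 0))
... | [] , _ , eq = trans (sym eq) (∣⊥∣≡0 (Graph.order G))

module Classes {G : Graph} (κ : Coloring G) where
  open Graph G
  open Coloring κ

  size : ℕ → ℕ
  size c = ∣ colorClass κ c ∣

  ∈-class⁻ : ∀ {v c} → v ∈ colorClass κ c → color v ≡ c
  ∈-class⁻ {v} {c} v∈ = holds (color v ≟ c) (trans (sym (lookup∘tabulate (λ v → does (color v ≟ c)) v)) ([]=⇒lookup v∈))
    where holds : ∀ {P : Set} (P? : Dec P) → does P? ≡ true → P
          holds (yes p) _ = p

  ∈-class⁺ : ∀ v → v ∈ colorClass κ (color v)
  ∈-class⁺ v = lookup⇒[]= v _ (trans (lookup∘tabulate (λ u → does (color u ≟ color v)) v) (dec-true (color v ≟ color v) refl))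

  used-or-empty : ∀ c → c List.∈ usedColors κ ⊎ size c ≡ 0
  used-or-empty c with elements (colorClass κ c) in eq | ∈-elements⁻ (colorClass κ c)
  ... | []    | _       = inj₂ (trans (sym (length-elements (colorClass κ c))) (cong length eq))
  ... | v ∷ _ | v∈ ∷ _  = inj₁ (subst (List._∈ usedColors κ) (∈-class⁻ v∈) (∈-deduplicate⁺ _≟_ (∈-map⁺ color (∈-allFin v))))

  classes : ∀ i → List ℕ → Vec (Subset order) i
  classes zero    _        = []
  classes (suc i) []       = ⊥ ∷ classes i []
  classes (suc i) (c ∷ cs) = colorClass κ c ∷ classes i cs

  class-stable : ∀ c → Stable G (colorClass κ c)
  class-stable c u v u∈ v∈ u~v = proper u v u~v (trans (∈-class⁻ u∈) (sym (∈-class⁻ v∈)))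

  classes-stable : ∀ i cs → VecAll.All (Stable G) (classes i cs)
  classes-stable zero    cs       = []
  classes-stable (suc i) []       = (λ _ _ u∈ → contradiction u∈ ∉⊥) ∷ classes-stable i []
  classes-stable (suc i) (c ∷ cs) = class-stable c ∷ classes-stable i cs

  ColoursIn : List ℕ → Subset order → Set
  ColoursIn cs S = ∀ {v} → v ∈ S → color v List.∈ cs

  classes-colours : ∀ i cs → VecAll.All (ColoursIn cs) (classes i cs)
  classes-colours zero    cs       = []
  classes-colours (suc i) []       = (λ v∈ → contradiction v∈ ∉⊥) ∷ classes-colours i []
  classes-colours (suc i) (c ∷ cs) = (λ v∈ → here (∈-class⁻ v∈)) ∷ VecAll.map (λ f {v} v∈ → there (f v∈)) (classes-colours i cs)

  ⋃-colours : ∀ {i} cs (Ss : Vec (Subset order) i) → VecAll.All (ColoursIn cs) Ss → ColoursIn cs (⋃ (toList Ss))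
  ⋃-colours cs Ss all v∈ with k , v∈k ← x∈⋃⁻ Ss v∈ = VecAll.lookup all (Vec∈-lookup k Ss) v∈k

  class-disjoint : ∀ {c cs S} → All (c ≢_) cs → ColoursIn cs S → Disjoint G (colorClass κ c) S
  class-disjoint {c} {cs} {S} c≢ cols (v , v∈) with v∈c , v∈S ← x∈p∩q⁻ (colorClass κ c) S v∈ =
    All.lookup c≢ (cols v∈S) (sym (∈-class⁻ v∈c))

  ⊥-disjoint : ∀ S → Disjoint G ⊥ S
  ⊥-disjoint S (v , v∈) = ∉⊥ (proj₁ (x∈p∩q⁻ ⊥ S v∈))

  classes-disjoint : ∀ i {cs} → Unique cs → VecAllPairs.AllPairs (Disjoint G) (classes i cs)
  classes-disjoint zero    _                   = []
  classes-disjoint (suc i) {[]}     []         = VecAll.universal ⊥-disjoint _ ∷ classes-disjoint i []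
  classes-disjoint (suc i) {c ∷ cs} (c≢ ∷ cs≢) =
    VecAll.map (λ {S} → class-disjoint {S = S} c≢) (classes-colours i cs) ∷ classes-disjoint i cs≢

  ∣⋃classes∣ : ∀ i {cs} → Unique cs → ∣ ⋃ (toList (classes i cs)) ∣ ≡ topSum i (map size cs)
  ∣⋃classes∣ zero    _                   = ∣⊥∣≡0 order
  ∣⋃classes∣ (suc i) {[]}     []         =
    trans (cong ∣_∣ (∪-identityˡ (⋃ (toList (classes i []))))) (trans (∣⋃classes∣ i []) (topSum-[] i))
    where topSum-[] : ∀ i → topSum i [] ≡ 0
          topSum-[] zero    = refl
          topSum-[] (suc i) = refl
  ∣⋃classes∣ (suc i) {c ∷ cs} (c≢ ∷ cs≢) = trans
    (∣p∪q∣≡∣p∣+∣q∣ (colorClass κ c) (⋃ (toList (classes i cs)))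
      (class-disjoint c≢ (⋃-colours cs (classes i cs) (classes-colours i cs))))
    (cong (size c +_) (∣⋃classes∣ i cs≢))

  topSum-≤-α : ∀ i {cs} → Unique cs → topSum i (map size cs) ≤ α G i
  topSum-≤-α i {cs} cs≢ = proj₂ (proj₂ (α-exists G i)) _
    (classes i cs , (classes-stable i cs , classes-disjoint i cs≢) , ∣⋃classes∣ i cs≢)

  shape-↭ : shape κ ↭ map size (usedColors κ)
  shape-↭ = sort-↭ (map size (usedColors κ))

  shape-≥ : AllPairs _≥_ (shape κ)
  shape-≥ = Linked⇒AllPairs (flip ≤-trans) (sort-↗ (map size (usedColors κ)))

  -- `↭-map-inv` presents the sorted sizes as the sizes of a reordered list of distinct colours,
  -- whose first i classes compete for α.
  topSum-shape-≤-α : ∀ i → topSum i (shape κ) ≤ α G i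
  topSum-shape-≤-α i with us , eq , p ← ↭-map-inv size (↭-sym shape-↭) rewrite eq =
    topSum-≤-α i (AllPairs-resp-↭ ≢-sym p (deduplicate-! _≟_ _))

  -- The colours in `cs` may come in any order of size: `topSum-domination` compares them with the i
  -- largest classes, and those are bounded by α.
  shape-realises-α : ∀ {cs} → Unique cs → ∀ i → α G i ≤ topSum i (map size cs) → topSum i (shape κ) ≡ α G i
  shape-realises-α {cs} cs≢ i α≤ = ≤-antisym (topSum-shape-≤-α i)
    (≤-trans α≤ (topSum-domination size shape-≥ shape-↭ cs≢ (All.universal used-or-empty cs) i))

-- Solving the game

Winnable : Vec ℕ 4 → Set
Winnable l = ∃[ cap ] ∃[ t ] (AllTree (Game.Safe cap l t) t × (∀ p → p ≤ cap → Game.Covers cap l t (Game.start cap l p)))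

-- The implicit argument is solved by evaluating `won?`, so type checking performs the finite
-- verification.
won : ∀ cap l {_ : True (Game.won? cap l)} → Winnable l
won cap l {w} with safe , started ← toWitness w =
  cap , Game.table cap l , safe , λ p p≤ → All.lookup started (∈-map⁺ (Game.start cap l) (∈-upTo⁺ (s≤s p≤)))

abstract
  -- Each cap is the least one for which this strategy works.
  winning : ∀ {a b c} → a ≤ 1 → b ≤ 2 → c ≤ 3 → a ≤ b → b ≤ c → Winnable (0 ∷ a ∷ b ∷ c ∷ [])
  winning {0} {0} {0} _ _ _ _ _ = won 4 (0 ∷ 0 ∷ 0 ∷ 0 ∷ [])
  winning {0} {0} {1} _ _ _ _ _ = won 3 (0 ∷ 0 ∷ 0 ∷ 1 ∷ [])
  winning {0} {0} {2} _ _ _ _ _ = won 3 (0 ∷ 0 ∷ 0 ∷ 2 ∷ [])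
  winning {0} {0} {3} _ _ _ _ _ = won 3 (0 ∷ 0 ∷ 0 ∷ 3 ∷ [])
  winning {0} {1} {1} _ _ _ _ _ = won 3 (0 ∷ 0 ∷ 1 ∷ 1 ∷ [])
  winning {0} {1} {2} _ _ _ _ _ = won 3 (0 ∷ 0 ∷ 1 ∷ 2 ∷ [])
  winning {0} {1} {3} _ _ _ _ _ = won 2 (0 ∷ 0 ∷ 1 ∷ 3 ∷ [])
  winning {0} {2} {2} _ _ _ _ _ = won 2 (0 ∷ 0 ∷ 2 ∷ 2 ∷ [])
  winning {0} {2} {3} _ _ _ _ _ = won 2 (0 ∷ 0 ∷ 2 ∷ 3 ∷ [])
  winning {1} {1} {1} _ _ _ _ _ = won 3 (0 ∷ 1 ∷ 1 ∷ 1 ∷ [])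
  winning {1} {1} {2} _ _ _ _ _ = won 2 (0 ∷ 1 ∷ 1 ∷ 2 ∷ [])
  winning {1} {1} {3} _ _ _ _ _ = won 2 (0 ∷ 1 ∷ 1 ∷ 3 ∷ [])
  winning {1} {2} {2} _ _ _ _ _ = won 2 (0 ∷ 1 ∷ 2 ∷ 2 ∷ [])
  winning {1} {2} {3} _ _ _ _ _ = won 1 (0 ∷ 1 ∷ 2 ∷ 3 ∷ [])
  winning {suc (suc _)} (s≤s ())
  winning {b = suc (suc (suc _))} _ (s≤s (s≤s ()))
  winning {c = suc (suc (suc (suc _)))} _ _ (s≤s (s≤s (s≤s ())))
  winning {1} {0} _ _ _ ()
  winning {b = 1} {0} _ _ _ _ ()
  winning {b = 2} {0} _ _ _ _ ()
  winning {b = 2} {1} _ _ _ _ (s≤s ())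

open Mark

-- Painting

Compatible-sym : Symmetric Compatible
Compatible-sym (f , g) = (λ r≡ → let c≢ , k≢ = f (sym r≡) in ≢-sym c≢ , ≢-sym k≢) , λ c≡ → ≢-sym (g (sym c≡))

AllPairs-lookup : ∀ {A : Set} {R : A → A → Set} → Symmetric R → ∀ {xs x y} → AllPairs R xs →
                  x List.∈ xs → y List.∈ xs → x ≡ y ⊎ R x y
AllPairs-lookup R-sym _        (here refl) (here refl) = inj₁ refl
AllPairs-lookup R-sym (x ∷ _)  (here refl) (there y∈)  = inj₂ (All.lookup x y∈)
AllPairs-lookup R-sym (x ∷ _)  (there x∈)  (here refl) = inj₂ (R-sym (All.lookup x x∈))
AllPairs-lookup R-sym (_ ∷ xs) (there x∈)  (there y∈)  = AllPairs-lookup R-sym xs x∈ y∈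

colourAt : List Mark → ℕ → ℕ → Maybe Colour
colourAt []      r c = nothing
colourAt (e ∷ E) r c with atRow e ≟ r | atCol e ≟ c
... | yes _ | yes _ = just (colour e)
... | yes _ | no  _ = colourAt E r c
... | no  _ | _     = colourAt E r c

colourAt⁻ : ∀ E {r c k} → colourAt E r c ≡ just k → mark k r c List.∈ E
colourAt⁻ (e ∷ E) {r} {c} eq with atRow e ≟ r | atCol e ≟ c
colourAt⁻ (e ∷ E) refl | yes refl | yes refl = here refl
colourAt⁻ (e ∷ E) eq   | yes _    | no _     = there (colourAt⁻ E eq)
colourAt⁻ (e ∷ E) eq   | no _     | _        = there (colourAt⁻ E eq)

-- Compatible marks never share a box, so the first match is the only one.
colourAt⁺ : ∀ {E r c k} → AllPairs Compatible E → mark k r c List.∈ E → colourAt E r c ≡ just k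
colourAt⁺ {e ∷ E} {r} {c} (e# ∷ E#) m∈ with atRow e ≟ r | atCol e ≟ c | m∈
... | yes _    | yes _    | here refl = refl
... | yes refl | yes refl | there m∈E = contradiction refl (proj₁ (proj₁ (All.lookup e# m∈E) refl))
... | yes _    | no c≢    | here refl = contradiction refl c≢
... | yes _    | no _     | there m∈E = colourAt⁺ E# m∈E
... | no r≢    | _        | here refl = contradiction refl r≢
... | no _     | _        | there m∈E = colourAt⁺ E# m∈E

length-filter : ∀ k E → length (filter (λ e → colour e Fin.≟ k) E) ≡ placed k E
length-filter k []      = refl
length-filter k (e ∷ E) with colour e Fin.≟ k
... | yes _ = cong suc (length-filter k E)
... | no  _ = length-filter k E

module Painting (μ : Partition) {E : List Mark} (compatible : AllPairs Compatible E)
                (inside : All (λ e → atCol e < entry (Partition.parts μ) (atRow e)) E) where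
  open Diagram μ

  paint : V → ℕ
  -- Each unmarked box gets a private colour, offset by 4 to avoid the colours of the marks.
  paint v = maybe′ toℕ (4 + toℕ v) (colourAt E (row μ v) (col μ v))

  paint-mark : ∀ {v k} → mark k (row μ v) (col μ v) List.∈ E → paint v ≡ toℕ k
  paint-mark {v} m∈ = cong (maybe′ toℕ (4 + toℕ v)) (colourAt⁺ compatible m∈)

  paint-proper : ∀ u v → Graph._~_ graph u v → paint u ≢ paint v
  paint-proper u v (u≢v , near) with colourAt E (row μ u) (col μ u) in eu | colourAt E (row μ v) (col μ v) in ev
  ... | nothing | nothing = u≢v ∘ Fin.toℕ-injective ∘ +-cancelˡ-≡ 4 _ _
  ... | nothing | just k  = λ eq → contradiction (Fin.toℕ<n k) (≤⇒≯ (≤-trans (m≤m+n 4 (toℕ u)) (≤-reflexive eq)))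
  ... | just k  | nothing = λ eq → contradiction (Fin.toℕ<n k) (≤⇒≯ (≤-trans (m≤m+n 4 (toℕ v)) (≤-reflexive (sym eq))))
  ... | just k  | just k′ with AllPairs-lookup Compatible-sym compatible (colourAt⁻ E eu) (colourAt⁻ E ev)
  ...   | inj₁ eq = contradiction (position-injective (cong atRow eq) (cong atCol eq)) u≢v
  ...   | inj₂ (sameRow , sameCol) = [ proj₂ ∘ sameRow , sameCol ]′ near ∘ Fin.toℕ-injective

  κ : Coloring graph
  κ = record { color = paint ; proper = paint-proper }

  open Classes κ

  -- Marks of one colour lie in distinct rows, so sending each to the vertex at its box is
  -- injective.
  placed-≤-size : ∀ k → placed k E ≤ size (toℕ k)
  placed-≤-size k = subst₂ _≤_ (length-filter k E) (length-elements (colorClass κ (toℕ k)))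
    (matching-length {R = At} (AllPairs.filter⁺ _ (AllPairs.map separate compatible))
      (All.zipWith vertex (All.all-filter _ E , All.tabulate filtered)))
    where
    At : Mark → V → Set
    At e v = colour e ≡ k × row μ v ≡ atRow e × col μ v ≡ atCol e
    separate : ∀ {e f} → Compatible e f → ∀ v → At e v → ¬ At f v
    separate (sameRow , _) v (refl , r≡ , _) (k≡ , r≡′ , _) = proj₂ (sameRow (trans (sym r≡) r≡′)) (sym k≡)
    filtered : ∀ {e} → e List.∈ filter (λ e → colour e Fin.≟ k) E → e List.∈ E
    filtered = proj₁ ∘ ∈-filter⁻ (λ e → colour e Fin.≟ k)
    vertex : ∀ {e} → colour e ≡ k × e List.∈ E → ∃[ v ] (At e v × v List.∈ elements (colorClass κ (toℕ k)))
    vertex {e} (refl , e∈) with v , r≡ , c≡ ← vertexAt (atRow e) (atCol e) (All.lookup inside e∈) =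
      v , (refl , r≡ , c≡) , ∈-elements⁺ _ (subst (λ c → v ∈ colorClass κ c) (paint-mark marked) (∈-class⁺ v))
      where
      marked : mark (colour e) (row μ v) (col μ v) List.∈ E
      marked = subst₂ (λ r c → mark (colour e) r c List.∈ E) (sym r≡) (sym c≡) e∈

total-loss : ∀ {n} (s : ℕ → ℕ) (l : Vec ℕ 4) → (∀ k → n ≤ s (toℕ k) + lookup l k) →
             ∀ i → suc (toℕ i) * n ≤ topSum (suc (toℕ i)) (map s (0 ∷ 1 ∷ 2 ∷ 3 ∷ [])) + loss l i
total-loss s l large 0F = ≤-trans (+-mono-≤ (large 0F) z≤n) (≤-reflexive (lem (s 0) (lookup l 0F)))
  where lem : ∀ a x → a + x + 0 ≡ a + 0 + x
        lem = solve-∀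
total-loss s l large 1F = ≤-trans (+-mono-≤ (large 0F) (+-mono-≤ (large 1F) z≤n))
  (≤-reflexive (lem (s 0) (s 1) (lookup l 0F) (lookup l 1F)))
  where lem : ∀ a b x y → a + x + (b + y + 0) ≡ a + (b + 0) + (x + y)
        lem = solve-∀
total-loss s l large 2F = ≤-trans (+-mono-≤ (large 0F) (+-mono-≤ (large 1F) (+-mono-≤ (large 2F) z≤n)))
  (≤-reflexive (lem (s 0) (s 1) (s 2) (lookup l 0F) (lookup l 1F) (lookup l 2F)))
  where lem : ∀ a b c x y z → a + x + (b + y + (c + z + 0)) ≡ a + (b + (c + 0)) + (x + y + z)
        lem = solve-∀
total-loss s l large 3F = ≤-trans (+-mono-≤ (large 0F) (+-mono-≤ (large 1F) (+-mono-≤ (large 2F) (+-mono-≤ (large 3F) z≤n))))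
  (≤-reflexive (lem (s 0) (s 1) (s 2) (s 3) (lookup l 0F) (lookup l 1F) (lookup l 2F) (lookup l 3F)))
  where lem : ∀ a b c d x y z w → a + x + (b + y + (c + z + (d + w + 0))) ≡ a + (b + (c + (d + 0))) + (x + y + z + w)
        lem = solve-∀

-- From the budget to the coloring

module Assembly (μ : Partition) where
  open Partition μ
  open Diagram μ

  parts≥ : AllPairs _≥_ parts
  parts≥ = Linked⇒AllPairs (flip ≤-trans) decreasing

  open Cuts parts parts≥ using (Budget; budgetOf)

  module _ (B : Budget) where
    open Budget B

    Marking : Set
    Marking = ∃[ E ] (AllPairs Compatible E × All (λ e → atCol e < entry parts (atRow e)) E ×
                      ∀ k → n ≤ placed k E + lookup budget k)

    -- The cut by all rows and no columns leaves nothing outside. This lets play begin at an index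
    -- of at least n.
    n≤rows : n ≤ length parts
    n≤rows = subst₂ _≤_ (*-identityˡ n)
      (trans (cong (λ ys → 1 * (length parts + 0) + outside ys 0 + 0) (drop-all (length parts) parts ≤-refl)) (lem (length parts)))
      (below 0F (length parts) 0)
      where lem : ∀ m → 1 * (m + 0) + 0 + 0 ≡ m
            lem = solve-∀

    marking : Winnable budget → Marking
    marking (cap , t , safe , started) = Run.marks parts n cap budget t safe started refl below parts≥ n≤rows

    realise : Marking → Σ[ κ ∈ Coloring graph ] (∀ (i : Fin 4) → entry (shape κ) (toℕ i) ≡ δ graph (suc (toℕ i)))
    realise (E , compatible , inside , count) = κ , λ i → trans (entry≡ (toℕ i)) (cong₂ _∸_ (realises-α i) (previous i))
      where
      open Painting μ compatible inside
      open Classes κ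
      cs : List ℕ
      cs = 0 ∷ 1 ∷ 2 ∷ 3 ∷ []
      cs≢ : Unique cs
      cs≢ = ((λ ()) ∷ (λ ()) ∷ (λ ()) ∷ []) ∷ ((λ ()) ∷ (λ ()) ∷ []) ∷ ((λ ()) ∷ []) ∷ [] ∷ []
      large : ∀ k → n ≤ size (toℕ k) + lookup budget k
      large k = ≤-trans (count k) (+-monoˡ-≤ (lookup budget k) (placed-≤-size k))
      -- At the tight cut, weak duality bounds α by (i + 1) n minus the loss, which the four classes
      -- reach by `total-loss`.
      α≤ : ∀ i → (∃[ r ] ∃[ c ] suc (toℕ i) * n ≡ cost (suc (toℕ i)) r c + loss budget i) →
           α graph (suc (toℕ i)) ≤ topSum (suc (toℕ i)) (map size cs)
      α≤ i (r , c , eq) = +-cancelʳ-≤ (loss budget i) _ _ (≤-trans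
        (+-monoˡ-≤ (loss budget i) (unionSize-≤-cost (proj₁ (proj₂ (α-exists graph (suc (toℕ i))))) r c))
        (≤-trans (≤-reflexive (sym eq)) (total-loss size budget large i)))
      realises-α : ∀ i → topSum (suc (toℕ i)) (shape κ) ≡ α graph (suc (toℕ i))
      realises-α i = shape-realises-α cs≢ (suc (toℕ i)) (α≤ i (tight i))
      previous : ∀ i → topSum (toℕ i) (shape κ) ≡ α graph (toℕ i)
      previous 0F = sym (α-0 graph)
      previous 1F = realises-α 0F
      previous 2F = realises-α 1F
      previous 3F = realises-α 2F
      entry≡ : ∀ i → entry (shape κ) i ≡ topSum (suc i) (shape κ) ∸ topSum i (shape κ)
      entry≡ i = sym (trans (cong (_∸ topSum i (shape κ)) (topSum-suc i (shape κ))) (m+n∸m≡n (topSum i (shape κ)) _))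

theorem3 : ∀ (μ : Partition) →
    Σ[ κ ∈ Coloring (partitionGraph μ) ]
    (∀ (i : Fin 4) → entry (shape κ) (toℕ i) ≡ δ (partitionGraph μ) (suc (toℕ i)))
theorem3 μ = realise B (marking B (winning l₂≤1 l₃≤2 l₄≤3 l₂≤l₃ l₃≤l₄))
  where
  open Assembly μ
  open Cuts (Partition.parts μ) parts≥ using (Budget; budgetOf)
  B : Budget
  B = budgetOf
  open Budget B
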